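{- Let $(a_n)_{n\ge0}$ be the sequence, listed in increasing order, of the non-negative integers $m$ such that $15m+4$ is a perfect square. Then $$\sum_{n=0}^\infty(-1)^{\lfloor (n+2)/4\rfloor}q^{a_n}=\frac{(q^2,q^6,q^8;q^8)_\infty\,(q^4,q^{12};q^{16})_\infty}{(q^2,q^3;q^5)_\infty}.$$
   Context: Here $q$ is a complex number with $|q|<1$ (equivalently, the identity may be read as an identity of formal power series in $q$). For a complex number $a$, $(a;q)_\infty:=\prod_{i=0}^\infty(1-aq^i)$, and $(a_1,a_2,\dots,a_m;q)_\infty:=\prod_{j=1}^m(a_j;q)_\infty$. $\lfloor x\rfloor$ is the floor function. -}

module Defs where

open import Data.Nat as ℕ using (ℕ; zero; suc; _∸_; _≡ᵇ_)
open import Data.Nat.DivMod using (_/_)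
open import Data.Nat.Divisibility using (_∣?_)
open import Data.Integer as ℤ using (ℤ; +_; -[1+_])
open import Data.Bool using (if_then_else_)
open import Relation.Nullary.Decidable using (does)

-- Formal power series in q with integer coefficients: n ↦ coefficient of q^n.
PS : Set
PS = ℕ → ℤ

Σ≤ : ℕ → (ℕ → ℤ) → ℤ
Σ≤ zero    f = f 0
Σ≤ (suc n) f = Σ≤ n f ℤ.+ f (suc n)

infixl 7 _⊛_
_⊛_ : PS → PS → PS
(f ⊛ g) N = Σ≤ N (λ i → f i ℤ.* g (N ∸ i))

𝟙 : PS
𝟙 zero    = + 1
𝟙 (suc _) = + 0

1-q^ : ℕ → PS
1-q^ k n = 𝟙 n ℤ.- (if n ≡ᵇ k then + 1 else + 0)

-- 1/(1 - q^k) = Σ_j q^{jk}   (used only with k ≥ 1)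
geom : ℕ → PS
geom k n = if does (k ∣? n) then + 1 else + 0

Π≤ : ℕ → (ℕ → PS) → PS
Π≤ zero    f = f 0
Π≤ (suc n) f = Π≤ n f ⊛ f (suc n)

-- (q^a ; q^b)_∞ = Π_{i≥0} (1 - q^{a+ib}) as a formal power series (a, b ≥ 1).
-- Since a + i b > N for i > N, the coefficient of q^N equals that of the
-- finite product over i = 0..N.
poch : ℕ → ℕ → PS
poch a b N = Π≤ N (λ i → 1-q^ (a ℕ.+ i ℕ.* b)) N

-- 1 / (q^a ; q^b)_∞ = Π_{i≥0} 1/(1 - q^{a+ib})  (a, b ≥ 1), same truncation.
invPoch : ℕ → ℕ → PS
invPoch a b N = Π≤ N (λ i → geom (a ℕ.+ i ℕ.* b)) N

sgn : ℕ → ℤ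
sgn n = -[1+ 0 ] ℤ.^ ((n ℕ.+ 2) / 4)

-- Σ_{n≥0} c n q^{e n}, for an exponent sequence with e n ≥ n
-- (true for strictly increasing e), so only n ≤ N contribute to q^N.
seriesAt : (ℕ → ℤ) → (ℕ → ℕ) → PS
seriesAt c e N = Σ≤ N (λ n → if e n ≡ᵇ N then c n else + 0)

rhs12 : PS
rhs12 = poch 2 8 ⊛ poch 6 8 ⊛ poch 8 8 ⊛ poch 4 16 ⊛ poch 12 16
        ⊛ invPoch 2 5 ⊛ invPoch 3 5

{-# OPTIONS --safe #-}

-- Both (q²,q⁶,q⁸;q⁸)(q⁴,q¹²;q¹⁶) and (q²,q⁴,q⁶,q⁸,q¹⁰;q¹⁰) equal (q²;q²), so the right-hand
-- side is (q⁴,q⁶,q¹⁰;q¹⁰) / (q³,q⁷;q¹⁰), the quintuple product with base Q = q¹⁰ at x = q³: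
--
--   Σ_{k ∈ ℤ} (-1)^k q^(15k²+4k) (1 + q^(10k+3)) = (Q, x², Q/x²; Q) / (x, Q/x; Q).
--
-- As 15(15k²+4k) + 4 = (15k+2)² and 15(15k²+14k+3) + 4 = (15k+7)², the exponents on the left are
-- exactly the m for which 15m+4 is a square.  The product formula is the limit of the finite
-- identities (after Chen, Chu and Gu; T_k is the k-th summand, (a)_n = (a;Q)_n)
--
--   Σ_{k=-a}^{b} T_k / ((Q)_{a+k} (Q)_{b-k} (x²)_{b+k+1} (Q/x²)_{a-k}) = 1 / ((Q)_{a+b} (x)_{b+1} (Q/x)_a)
--
-- for (a,b) = (m,m) and (m+1,m): increasing a or b by one multiplies both sides by the same factor
-- up to a telescoping sum.  All this takes place in ℤ[q]/(q^(N+1)), where infinite products are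
-- finite and the coefficient of q^N can be read off.

module Submission where

open import Defs
open import Algebra.Bundles using (CommutativeRing)
open import Algebra.Core using (Op₁; Op₂)
open import Algebra.Solver.Ring.AlmostCommutativeRing using (_-Raw-AlmostCommutative⟶_; fromCommutativeRing)
import Algebra.Solver.Ring as RingSolver
open import Algebra.Structures using (IsCommutativeRing)
open import Data.Bool.Base using (if_then_else_; true; false)
open import Data.Integer as ℤ using (ℤ; +_; -[1+_]; _⊖_) renaming (_+_ to _+ᶻ_; _*_ to _*ᶻ_; _-_ to _-ᶻ_; -_ to -ᶻ_)
import Data.Integer.Properties as ℤ
import Data.Integer.Tactic.RingSolver as ℤ-Ring
open import Data.Maybe.Base using (Maybe; just; nothing)
open import Data.Nat as ℕ using (ℕ; zero; suc; _<_; _≤_; z≤n; s≤s; _∸_; _≡ᵇ_)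
open import Data.Nat.Divisibility using (_∣?_; _∣0; >⇒∤; ∣m+n∣m⇒∣n; ∣m∣n⇒∣m+n; ∣-refl; divides)
open import Data.Nat.DivMod using (_/_; _%_; m≡m%n+[m/n]*n; m%n<n; [m+kn]%n≡m%n; +-distrib-/-∣ʳ; m*n/n≡m)
import Data.Nat.Properties as ℕ
import Data.Nat.Tactic.RingSolver as ℕ-Ring
open import Data.Product using (_,_; ∃-syntax; proj₁; proj₂)
open import Data.Sum using (inj₁; inj₂)
open import Function.Base using (_∘_)
open import Function.Bundles using (_⇔_; mk⇔; Equivalence)
open import Level using (0ℓ)
open import Relation.Binary.Core using (Rel)
open import Relation.Binary.PropositionalEquality as ≡ using (_≡_)
import Relation.Binary.Reasoning.Setoid as SetoidReasoning
open import Relation.Nullary using (yes; no; contradiction)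
open import Relation.Nullary.Decidable using (does-⇔; dec-true; dec-false)

-- Exponents of the theta series

module Exponents where

  open import Data.Nat using (_+_; _*_)

  -- u k = 15k² + 4k and v k = 15k² + 14k + 3, which are non-negative for every integer k.
  u v : ℤ → ℕ
  u (+ n)    = n * (15 * n + 4)
  u -[1+ n ] = suc n * (15 * n + 11)
  v (+ n)    = (5 * n + 3) * (3 * n + 1)
  v -[1+ n ] = (5 * n + 2) * (3 * n + 2)

  private
    pos-affine : ∀ a n b → + (a * n + b) ≡ + a *ᶻ + n +ᶻ + b
    pos-affine a n b = ≡.cong (_+ᶻ + b) (ℤ.pos-* a n)

  -- Removes the case split on the sign of k: over ℤ each exponent is one polynomial in k, so every
  -- exponent relation below reduces to a single polynomial identity.
  pos-u : ∀ k → + u k ≡ k *ᶻ (+ 15 *ᶻ k +ᶻ + 4)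
  pos-u (+ n)    = ≡.trans (ℤ.pos-* n _) (≡.cong (_*ᶻ_ (+ n)) (pos-affine 15 n 4))
  pos-u -[1+ n ] = ≡.trans (ℤ.pos-* (suc n) _)
    (≡.trans (≡.cong (_*ᶻ_ (+ suc n)) (pos-affine 15 n 11)) (lemma (+ n)))
    where
    lemma : ∀ x → (+ 1 +ᶻ x) *ᶻ (+ 15 *ᶻ x +ᶻ + 11) ≡
      (-ᶻ (+ 1 +ᶻ x)) *ᶻ (+ 15 *ᶻ (-ᶻ (+ 1 +ᶻ x)) +ᶻ + 4)
    lemma = ℤ-Ring.solve-∀

  pos-v : ∀ k → + v k ≡ (+ 5 *ᶻ k +ᶻ + 3) *ᶻ (+ 3 *ᶻ k +ᶻ + 1)
  pos-v (+ n)    = ≡.trans (ℤ.pos-* (5 * n + 3) _) (≡.cong₂ _*ᶻ_ (pos-affine 5 n 3) (pos-affine 3 n 1))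
  pos-v -[1+ n ] = ≡.trans (ℤ.pos-* (5 * n + 2) _)
    (≡.trans (≡.cong₂ _*ᶻ_ (pos-affine 5 n 2) (pos-affine 3 n 2)) (lemma (+ n)))
    where
    lemma : ∀ x → (+ 5 *ᶻ x +ᶻ + 2) *ᶻ (+ 3 *ᶻ x +ᶻ + 2) ≡
      (+ 5 *ᶻ (-ᶻ (+ 1 +ᶻ x)) +ᶻ + 3) *ᶻ (+ 3 *ᶻ (-ᶻ (+ 1 +ᶻ x)) +ᶻ + 1)
    lemma = ℤ-Ring.solve-∀

  ⊖-sucˡ : ∀ i m → suc i ⊖ m ≡ + 1 +ᶻ (i ⊖ m)
  ⊖-sucˡ i m = ≡.trans (≡.sym (ℤ.m-n≡m⊖n (suc i) m))
    (≡.trans (ℤ.+-assoc (+ 1) (+ i) (-ᶻ + m)) (≡.cong (_+ᶻ_ (+ 1)) (ℤ.m-n≡m⊖n i m)))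

  private
    pos-offset : ∀ a {n n′} → + n ≡ n′ → + (a + n * 10) ≡ + a +ᶻ n′ *ᶻ + 10
    pos-offset a {n} ≡.refl = ≡.cong (_+ᶻ_ (+ a)) (ℤ.pos-* n 10)

    pos-left : ∀ i m → + i ≡ (i ⊖ m) +ᶻ + m
    pos-left i m = ≡.trans (lemma (+ i) (+ m)) (≡.cong (_+ᶻ + m) (ℤ.m-n≡m⊖n i m))
      where
      lemma : ∀ x y → x ≡ (x -ᶻ y) +ᶻ y
      lemma = ℤ-Ring.solve-∀

    -- Here d is the shortfall of i + j below 2m. It lets one lemma solve for j in terms of m and k
    -- = i - m in all four index situations.
    pos-right : ∀ d m i j → i + (d + j) ≡ m * 2 → + j ≡ + m -ᶻ (i ⊖ m) -ᶻ + d
    pos-right d m i j eq = ≡.trans (lemma (+ i) (+ j) (+ m) hyp)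
      (≡.cong (λ k → + m -ᶻ k -ᶻ + d) (ℤ.m-n≡m⊖n i m))
      where
      hyp : + i +ᶻ (+ d +ᶻ + j) ≡ + m *ᶻ + 2
      hyp = ≡.trans (≡.cong +_ eq) (ℤ.pos-* m 2)
      isolate : ∀ D x y → y ≡ (x +ᶻ (D +ᶻ y)) -ᶻ x -ᶻ D
      isolate = ℤ-Ring.solve-∀
      rearrange : ∀ D x w → (w *ᶻ + 2) -ᶻ x -ᶻ D ≡ w -ᶻ (x -ᶻ w) -ᶻ D
      rearrange = ℤ-Ring.solve-∀
      lemma : ∀ x y w → x +ᶻ (+ d +ᶻ y) ≡ w *ᶻ + 2 → y ≡ w -ᶻ (x -ᶻ w) -ᶻ + d
      lemma x y w h = ≡.trans (isolate (+ d) x y)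
        (≡.trans (≡.cong (λ z → z -ᶻ x -ᶻ + d) h) (rearrange (+ d) x w))

    descend : ∀ {x y x′ y′} → + x ≡ x′ → + y ≡ y′ → x′ ≡ y′ → x ≡ y
    descend p q r = ℤ.+-injective (≡.trans p (≡.trans r (≡.sym q)))

  module _ (m i j : ℕ) (i+j≡2m : i + j ≡ m * 2) where
    private
      k = i ⊖ m

    -- With w = q^(10m+3), J = q^(10j) and Y = q^(10i+6), this and `balanced-v` give wU = JV and wV
    -- = YU, the hypotheses of `balanced-term`.
    balanced-u : (3 + m * 10) + u k ≡ j * 10 + v k
    balanced-u = descend
      (≡.cong₂ _+ᶻ_ (pos-offset 3 {m} ≡.refl) (pos-u k))
      (≡.cong₂ _+ᶻ_ (pos-offset 0 (pos-right 0 m i j i+j≡2m)) (pos-v k))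
      (lemma (+ m) k)
      where
      lemma : ∀ M K →
        (+ 3 +ᶻ M *ᶻ + 10) +ᶻ K *ᶻ (+ 15 *ᶻ K +ᶻ + 4) ≡
        (+ 0 +ᶻ (M -ᶻ K -ᶻ + 0) *ᶻ + 10) +ᶻ (+ 5 *ᶻ K +ᶻ + 3) *ᶻ (+ 3 *ᶻ K +ᶻ + 1)
      lemma = ℤ-Ring.solve-∀

    balanced-v : (3 + m * 10) + v k ≡ (6 + i * 10) + u k
    balanced-v = descend
      (≡.cong₂ _+ᶻ_ (pos-offset 3 {m} ≡.refl) (pos-v k))
      (≡.cong₂ _+ᶻ_ (pos-offset 6 (pos-left i m)) (pos-u k))
      (lemma (+ m) k)
      where
      lemma : ∀ M K →
        (+ 3 +ᶻ M *ᶻ + 10) +ᶻ (+ 5 *ᶻ K +ᶻ + 3) *ᶻ (+ 3 *ᶻ K +ᶻ + 1) ≡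
        (+ 6 +ᶻ (K +ᶻ M) *ᶻ + 10) +ᶻ K *ᶻ (+ 15 *ᶻ K +ᶻ + 4)
      lemma = ℤ-Ring.solve-∀

  -- Matches the exponents of the two leftover terms belonging to k and k + 1. As (-1)^k changes
  -- sign between them, they cancel in the telescoping sum; `skew-shift` plays the same part for the
  -- other recurrence.
  balanced-shift : ∀ m i j → i + suc j ≡ m * 2 →
    (6 + i * 10) + v (i ⊖ m) ≡ j * 10 + u (suc i ⊖ m)
  balanced-shift m i j eq rewrite ⊖-sucˡ i m = descend
    (≡.cong₂ _+ᶻ_ (pos-offset 6 (pos-left i m)) (pos-v k))
    (≡.cong₂ _+ᶻ_ (pos-offset 0 {j} (pos-right 1 m i j eq)) (pos-u (+ 1 +ᶻ k)))
    (lemma (+ m) k)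
    where
    k = i ⊖ m
    lemma : ∀ M K →
      (+ 6 +ᶻ (K +ᶻ M) *ᶻ + 10) +ᶻ (+ 5 *ᶻ K +ᶻ + 3) *ᶻ (+ 3 *ᶻ K +ᶻ + 1) ≡
      (+ 0 +ᶻ (M -ᶻ K -ᶻ + 1) *ᶻ + 10) +ᶻ (+ 1 +ᶻ K) *ᶻ (+ 15 *ᶻ (+ 1 +ᶻ K) +ᶻ + 4)
    lemma = ℤ-Ring.solve-∀

  module _ (m i j : ℕ) (i+j≡2m+1 : i + j ≡ suc (m * 2)) where
    private
      k = i ⊖ suc m

      pos-j : + j ≡ + suc m -ᶻ k -ᶻ + 1
      pos-j = pos-right 1 (suc m) i j (≡.trans (ℕ.+-suc i j) (≡.cong suc i+j≡2m+1))

    -- With w = q^(10m+7), I = q^(10i) and Z = q^(10j+4), this and `skew-u` give wV = IU and wU =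
    -- ZV, the hypotheses of `skew-term`.
    skew-v : (7 + m * 10) + v k ≡ i * 10 + u k
    skew-v = descend
      (≡.cong₂ _+ᶻ_ (pos-offset 7 {m} ≡.refl) (pos-v k))
      (≡.cong₂ _+ᶻ_ (pos-offset 0 (pos-left i (suc m))) (pos-u k))
      (lemma (+ m) k)
      where
      lemma : ∀ M K →
        (+ 7 +ᶻ M *ᶻ + 10) +ᶻ (+ 5 *ᶻ K +ᶻ + 3) *ᶻ (+ 3 *ᶻ K +ᶻ + 1) ≡
        (+ 0 +ᶻ (K +ᶻ (+ 1 +ᶻ M)) *ᶻ + 10) +ᶻ K *ᶻ (+ 15 *ᶻ K +ᶻ + 4)
      lemma = ℤ-Ring.solve-∀

    skew-u : (7 + m * 10) + u k ≡ (4 + j * 10) + v k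
    skew-u = descend
      (≡.cong₂ _+ᶻ_ (pos-offset 7 {m} ≡.refl) (pos-u k))
      (≡.cong₂ _+ᶻ_ (pos-offset 4 pos-j) (pos-v k))
      (lemma (+ m) k)
      where
      lemma : ∀ M K →
        (+ 7 +ᶻ M *ᶻ + 10) +ᶻ K *ᶻ (+ 15 *ᶻ K +ᶻ + 4) ≡
        (+ 4 +ᶻ ((+ 1 +ᶻ M) -ᶻ K -ᶻ + 1) *ᶻ + 10) +ᶻ (+ 5 *ᶻ K +ᶻ + 3) *ᶻ (+ 3 *ᶻ K +ᶻ + 1)
      lemma = ℤ-Ring.solve-∀

  skew-shift : ∀ m i j → i + j ≡ m * 2 →
    i * 10 + v (i ⊖ suc m) ≡ (4 + j * 10) + u (suc i ⊖ suc m)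
  skew-shift m i j eq rewrite ⊖-sucˡ i (suc m) = descend
    (≡.cong₂ _+ᶻ_ (pos-offset 0 (pos-left i (suc m))) (pos-v k))
    (≡.cong₂ _+ᶻ_ (pos-offset 4 pos-j) (pos-u (+ 1 +ᶻ k)))
    (lemma (+ m) k)
    where
    k = i ⊖ suc m
    pos-j : + j ≡ + suc m -ᶻ k -ᶻ + 2
    pos-j = pos-right 2 (suc m) i j
      (≡.trans (ℕ.+-suc i (suc j)) (≡.cong suc (≡.trans (ℕ.+-suc i j) (≡.cong suc eq))))
    lemma : ∀ M K →
      (+ 0 +ᶻ (K +ᶻ (+ 1 +ᶻ M)) *ᶻ + 10) +ᶻ (+ 5 *ᶻ K +ᶻ + 3) *ᶻ (+ 3 *ᶻ K +ᶻ + 1) ≡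
      (+ 4 +ᶻ ((+ 1 +ᶻ M) -ᶻ K -ᶻ + 2) *ᶻ + 10) +ᶻ (+ 1 +ᶻ K) *ᶻ (+ 15 *ᶻ (+ 1 +ᶻ K) +ᶻ + 4)
    lemma = ℤ-Ring.solve-∀

  -- Ensures that only the terms with |k| ≤ N survive modulo q^(N+1).
  ∣k∣≤u : ∀ k → ℤ.∣ k ∣ ≤ u k
  ∣k∣≤u (+ n)    = ≡.subst (n ≤_) (lemma n) (ℕ.m≤m+n n _)
    where
    lemma : ∀ n → n + n * (15 * n + 3) ≡ n * (15 * n + 4)
    lemma = ℕ-Ring.solve-∀
  ∣k∣≤u -[1+ n ] = ≡.subst (suc n ≤_) (lemma n) (ℕ.m≤m+n (suc n) _)
    where
    lemma : ∀ n → suc n + suc n * (15 * n + 10) ≡ suc n * (15 * n + 11)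
    lemma = ℕ-Ring.solve-∀

  ∣k∣≤v : ∀ k → ℤ.∣ k ∣ ≤ v k
  ∣k∣≤v (+ n)    = ≡.subst (n ≤_) (lemma n) (ℕ.m≤m+n n _)
    where
    lemma : ∀ n → n + (15 * n * n + 13 * n + 3) ≡ (5 * n + 3) * (3 * n + 1)
    lemma = ℕ-Ring.solve-∀
  ∣k∣≤v -[1+ n ] = ≡.subst (suc n ≤_) (lemma n) (ℕ.m≤m+n (suc n) _)
    where
    lemma : ∀ n → suc n + (15 * n * n + 15 * n + 3) ≡ (5 * n + 2) * (3 * n + 2)
    lemma = ℕ-Ring.solve-∀

open Exponents

-- The finite identities

-- The units are literally ⟦ + 0 ⟧ and ⟦ + 1 ⟧, so that the ring solver with
-- integer coefficients produces the ring's own constants.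
record ℤ-Algebra : Set₁ where
  infix  8 -_
  infixl 7 _*_
  infixl 6 _+_
  infix  4 _≈_
  field
    Carrier           : Set
    _≈_               : Rel Carrier 0ℓ
    _+_ _*_           : Op₂ Carrier
    -_                : Op₁ Carrier
    ⟦_⟧               : ℤ → Carrier
    isCommutativeRing : IsCommutativeRing _≈_ _+_ _*_ -_ ⟦ + 0 ⟧ ⟦ + 1 ⟧
    ⟦⟧-+              : ∀ a b → ⟦ a ℤ.+ b ⟧ ≈ ⟦ a ⟧ + ⟦ b ⟧
    ⟦⟧-*              : ∀ a b → ⟦ a ℤ.* b ⟧ ≈ ⟦ a ⟧ * ⟦ b ⟧
    ⟦⟧--              : ∀ a → ⟦ ℤ.- a ⟧ ≈ - ⟦ a ⟧

  commutativeRing : CommutativeRing 0ℓ 0ℓ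
  commutativeRing = record { isCommutativeRing = isCommutativeRing }

-- Finite products, antidiagonal sums and signs in a commutative ring.

module RingLemmas (A : ℤ-Algebra) where

  open ℤ-Algebra A using (⟦_⟧; ⟦⟧-+; ⟦⟧-*; ⟦⟧--; commutativeRing)
  open CommutativeRing commutativeRing
  open SetoidReasoning setoid

  private
    ℤ⟶A : ℤ.+-*-rawRing -Raw-AlmostCommutative⟶ fromCommutativeRing commutativeRing
    ℤ⟶A = record
      { ⟦_⟧ = ⟦_⟧ ; +-homo = ⟦⟧-+ ; *-homo = ⟦⟧-* ; -‿homo = ⟦⟧-- ; 0-homo = refl ; 1-homo = refl }

    _≟_ : ∀ x y → Maybe (⟦ x ⟧ ≈ ⟦ y ⟧)
    x ≟ y with x ℤ.≟ y
    ... | yes ≡.refl = just refl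
    ... | no  _      = nothing

    module Solver = RingSolver ℤ.+-*-rawRing (fromCommutativeRing commutativeRing) ℤ⟶A _≟_
  open Solver using (solve; _:=_; _:+_; _:*_; _:-_; :-_; con) public

  :0 :1 : ∀ {n} → Solver.Polynomial n
  :0 = con (+ 0)
  :1 = con (+ 1)

  ∏ : ℕ → (ℕ → Carrier) → Carrier
  ∏ zero    f = 1#
  ∏ (suc n) f = ∏ n f * f n

  ∏-cong : ∀ n {f g} → (∀ i → f i ≈ g i) → ∏ n f ≈ ∏ n g
  ∏-cong zero    h = refl
  ∏-cong (suc n) h = *-cong (∏-cong n h) (h n)

  ∏-* : ∀ n f g → ∏ n (λ i → f i * g i) ≈ ∏ n f * ∏ n g
  ∏-* zero    f g = sym (*-identityˡ 1#)
  ∏-* (suc n) f g = trans (*-congʳ (∏-* n f g))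
    (solve 4 (λ a b x y → (a :* b) :* (x :* y) := (a :* x) :* (b :* y)) refl _ _ _ _)

  ∏-1 : ∀ n {f} → (∀ i → f i ≈ 1#) → ∏ n f ≈ 1#
  ∏-1 zero    h = refl
  ∏-1 (suc n) h = trans (*-cong (∏-1 n h) (h n)) (*-identityˡ 1#)

  ∏-+ : ∀ d k f → ∏ (d ℕ.+ k) f ≈ ∏ k f * ∏ d (λ r → f (r ℕ.+ k))
  ∏-+ zero    k f = sym (*-identityʳ _)
  ∏-+ (suc d) k f = trans (*-congʳ (∏-+ d k f)) (*-assoc _ _ _)

  -- Sorts the indices below nd by their residue modulo d.
  ∏-sections : ∀ d n f → ∏ (n ℕ.* d) f ≈ ∏ d (λ r → ∏ n (λ i → f (r ℕ.+ i ℕ.* d)))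
  ∏-sections d zero    f = sym (∏-1 d λ _ → refl)
  ∏-sections d (suc n) f = begin
    ∏ (d ℕ.+ n ℕ.* d) f
      ≈⟨ ∏-+ d (n ℕ.* d) f ⟩
    ∏ (n ℕ.* d) f * ∏ d (λ r → f (r ℕ.+ n ℕ.* d))
      ≈⟨ *-congʳ (∏-sections d n f) ⟩
    ∏ d (λ r → ∏ n (λ i → f (r ℕ.+ i ℕ.* d))) * ∏ d (λ r → f (r ℕ.+ n ℕ.* d))
      ≈⟨ ∏-* d _ _ ⟨
    ∏ d (λ r → ∏ (suc n) (λ i → f (r ℕ.+ i ℕ.* d))) ∎

  ∏-stable : ∀ N {f} → (∀ i → N < i → f i ≈ 1#) → ∀ n → N < n → ∏ n f ≈ ∏ (suc N) f
  ∏-stable N {f} f≈1 n N<n = trans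
    (reflexive (≡.cong (λ l → ∏ l f) (≡.sym (ℕ.m∸n+n≡m N<n))))
    (trans (∏-+ (n ∸ suc N) (suc N) f)
      (trans (*-congˡ (∏-1 (n ∸ suc N) λ r → f≈1 _ (ℕ.m≤n+m (suc N) r))) (*-identityʳ _)))

  ∑ : ℕ → (ℕ → Carrier) → Carrier
  ∑ zero    f = f 0
  ∑ (suc n) f = ∑ n f + f (suc n)

  -- Summing over pairs with i + j = n treats both lengths symmetrically and avoids truncated
  -- subtraction in the summands.
  antidiagonal : ℕ → (ℕ → ℕ → Carrier) → Carrier
  antidiagonal zero    f = f 0 0
  antidiagonal (suc n) f = f 0 (suc n) + antidiagonal n (f ∘ suc)

  antidiagonal-cong : ∀ n {f g} → (∀ i j → i ℕ.+ j ≡ n → f i j ≈ g i j) →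
    antidiagonal n f ≈ antidiagonal n g
  antidiagonal-cong zero    h = h 0 0 ≡.refl
  antidiagonal-cong (suc n) h =
    +-cong (h 0 (suc n) ≡.refl) (antidiagonal-cong n λ i j eq → h (suc i) j (≡.cong suc eq))

  antidiagonal-+ : ∀ n f g →
    antidiagonal n (λ i j → f i j + g i j) ≈ antidiagonal n f + antidiagonal n g
  antidiagonal-+ zero    f g = refl
  antidiagonal-+ (suc n) f g = trans (+-congˡ (antidiagonal-+ n (f ∘ suc) (g ∘ suc)))
    (solve 4 (λ a b x y → (a :+ b) :+ (x :+ y) := (a :+ x) :+ (b :+ y)) refl _ _ _ _)

  antidiagonal-*ˡ : ∀ n x f → antidiagonal n (λ i j → x * f i j) ≈ x * antidiagonal n f
  antidiagonal-*ˡ zero    x f = refl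
  antidiagonal-*ˡ (suc n) x f =
    trans (+-congˡ (antidiagonal-*ˡ n x (f ∘ suc))) (sym (distribˡ x _ _))

  antidiagonal-*ʳ : ∀ n f x → antidiagonal n (λ i j → f i j * x) ≈ antidiagonal n f * x
  antidiagonal-*ʳ zero    f x = refl
  antidiagonal-*ʳ (suc n) f x =
    trans (+-congˡ (antidiagonal-*ʳ n (f ∘ suc) x)) (sym (distribʳ x _ _))

  antidiagonal-last : ∀ n f →
    antidiagonal (suc n) f ≈ antidiagonal n (λ i j → f i (suc j)) + f (suc n) 0
  antidiagonal-last zero    f = refl
  antidiagonal-last (suc n) f =
    trans (+-congˡ (antidiagonal-last n (f ∘ suc))) (sym (+-assoc _ _ _))

  -- The sum of `a` loses its end i = 0 and the sum of `b` its end j = 0. What remains are two sums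
  -- over i + j = n that cancel term by term.
  antidiagonal-telescope : ∀ n a b →
    (∀ j → a 0 j ≈ 0#) → (∀ i → b i 0 ≈ 0#) →
    (∀ i j → i ℕ.+ j ≡ n → b i (suc j) + a (suc i) j ≈ 0#) →
    antidiagonal (suc n) (λ i j → a i j + b i j) ≈ 0#
  antidiagonal-telescope n a b a₀ b₀ cancel = begin
    antidiagonal (suc n) (λ i j → a i j + b i j)
      ≈⟨ antidiagonal-+ (suc n) a b ⟩
    (a 0 (suc n) + antidiagonal n (a ∘ suc)) + antidiagonal (suc n) b
      ≈⟨ +-cong (+-congʳ (a₀ _)) (trans (antidiagonal-last n b) (+-congˡ (b₀ _))) ⟩
    (0# + antidiagonal n (a ∘ suc)) + (antidiagonal n b⁺ + 0#)
      ≈⟨ solve 2 (λ x y → (:0 :+ x) :+ (y :+ :0) := y :+ x) refl _ _ ⟩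
    antidiagonal n b⁺ + antidiagonal n (a ∘ suc)
      ≈⟨ antidiagonal-+ n b⁺ (a ∘ suc) ⟨
    antidiagonal n (λ i j → b⁺ i j + a (suc i) j)
      ≈⟨ antidiagonal-cong n cancel ⟩
    antidiagonal n (λ _ _ → 0#)
      ≈⟨ zeros n ⟩
    0# ∎
    where
    b⁺ : ℕ → ℕ → Carrier
    b⁺ i j = b i (suc j)
    zeros : ∀ n → antidiagonal n (λ _ _ → 0#) ≈ 0#
    zeros zero    = refl
    zeros (suc n) = trans (+-identityˡ _) (zeros n)

  -- The sign (-1)^k in the ring, for k of either sign.
  ε : ℤ → Carrier
  ε (+ zero)     = 1#
  ε (+ suc n)    = - ε (+ n)
  ε -[1+ zero ]  = - 1#
  ε -[1+ suc n ] = - ε -[1+ n ]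

  ε-suc : ∀ k → ε (+ 1 ℤ.+ k) ≈ - ε k
  ε-suc (+ n)        = refl
  ε-suc -[1+ zero ]  = solve 0 (:1 := :- (:- :1)) refl
  ε-suc -[1+ suc n ] = solve 1 (λ x → x := :- (:- x)) refl _

  -- Finite forms of the quintuple product identity, by recurrence.

  module FiniteQuintuple
    (pow inv : ℕ → Carrier)
    (pow-0   : pow 0 ≈ 1#)
    (pow-+   : ∀ a b → pow (a ℕ.+ b) ≈ pow a * pow b)
    (inverse : ∀ k → inv (suc k) * (1# - pow (suc k)) ≈ 1#)
    where

    cancel-factor : ∀ k {x y} → (1# - pow (suc k)) * x ≈ (1# - pow (suc k)) * y → x ≈ y
    cancel-factor k {x} {y} eq = begin
      x                                    ≈⟨ *-identityˡ x ⟨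
      1# * x                               ≈⟨ *-congʳ (inverse k) ⟨
      inv (suc k) * (1# - pow (suc k)) * x ≈⟨ *-assoc _ _ _ ⟩
      inv (suc k) * ((1# - pow (suc k)) * x) ≈⟨ *-congˡ eq ⟩
      inv (suc k) * ((1# - pow (suc k)) * y) ≈⟨ *-assoc _ _ _ ⟨
      inv (suc k) * (1# - pow (suc k)) * y ≈⟨ *-congʳ (inverse k) ⟩
      1# * y                               ≈⟨ *-identityˡ y ⟩
      y ∎

    -- 1 / (q^a ; q^10)_n
    recip : ℕ → ℕ → Carrier
    recip a n = ∏ n (λ i → inv (a ℕ.+ i ℕ.* 10))

    -- Clears the last denominator. Writing `suc a` keeps the exponent positive, where 1 - q^e is
    -- invertible.
    recip-suc : ∀ a n → (1# - pow (suc a ℕ.+ n ℕ.* 10)) * recip (suc a) (suc n) ≈ recip (suc a) n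
    recip-suc a n = trans
      (solve 3 (λ x y z → x :* (y :* z) := y :* (z :* x)) refl _ _ _)
      (trans (*-congˡ (inverse (a ℕ.+ n ℕ.* 10))) (*-identityʳ _))

    U V T : ℤ → Carrier
    U k = ε k * pow (u k)
    V k = ε k * pow (v k)
    T k = U k + V k

    pow-relation : ∀ {a b c d} s → a ℕ.+ b ≡ c ℕ.+ d → pow a * (s * pow b) ≈ pow c * (s * pow d)
    pow-relation {a} {b} {c} {d} s eq = begin
      pow a * (s * pow b) ≈⟨ solve 3 (λ x y z → x :* (y :* z) := y :* (x :* z)) refl _ _ _ ⟩
      s * (pow a * pow b) ≈⟨ *-congˡ (pow-+ a b) ⟨
      s * pow (a ℕ.+ b)   ≡⟨ ≡.cong (λ e → s * pow e) eq ⟩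
      s * pow (c ℕ.+ d)   ≈⟨ *-congˡ (pow-+ c d) ⟩
      s * (pow c * pow d) ≈⟨ solve 3 (λ x y z → y :* (x :* z) := x :* (y :* z)) refl _ _ _ ⟩
      pow c * (s * pow d) ∎

    pow-opposite : ∀ {a b c d} s s′ → s′ ≈ - s → a ℕ.+ b ≡ c ℕ.+ d →
      pow a * (s * pow b) + pow c * (s′ * pow d) ≈ 0#
    pow-opposite {a} {b} {c} {d} s s′ opp eq = begin
      pow a * (s * pow b) + pow c * (s′ * pow d)
        ≈⟨ +-cong (pow-relation s eq) (*-congˡ (*-congʳ opp)) ⟩
      pow c * (s * pow d) + pow c * (- s * pow d)
        ≈⟨ solve 3 (λ x y z → x :* (y :* z) :+ x :* (:- y :* z) := :0) refl _ _ _ ⟩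
      0# ∎

    -- With k the index of T, the pair (i , j) is (m + 1 + k , m − k) in `skew-sum m` and
    -- (m + k , m − k) in `balanced-sum m` below.
    skew balanced : ℕ → ℕ → Carrier
    skew     i j = (recip 10 i * recip 10 j) * (recip 6 i * recip 4 (suc j))
    balanced i j = (recip 10 i * recip 10 j) * (recip 6 (suc i) * recip 4 j)

    factor : ℕ → Carrier
    factor e = 1# - pow e

    factor-0 : factor 0 ≈ 0#
    factor-0 = trans (+-congˡ (-‿cong pow-0)) (-‿inverseʳ 1#)

    -- The two hypotheses turn (1 - w)(U + V) into (1 - Y)U + (1 - J)V. Then 1 - IJ is written as (1
    -- - J) + J(1 - I) in the U term and as (1 - Y) + (Y - IJ) in the V term. The first parts
    -- combine to the wanted summand, the second parts will telescope.
    balanced-term : ∀ U V I J Y w c → w * U ≈ J * V → w * V ≈ Y * U →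
      (1# - I * J) * (1# - w) * ((U + V) * c) ≈
      (U + V) * ((1# - J) * (1# - Y) * c) +
        (J * (1# - I) * (1# - Y) * (U * c) + (Y - I * J) * (1# - J) * (V * c))
    balanced-term U V I J Y w c wU wV = begin
      (1# - I * J) * (1# - w) * ((U + V) * c)
        ≈⟨ solve 6 (λ U V I J w c →
             (:1 :- I :* J) :* (:1 :- w) :* ((U :+ V) :* c) :=
             (:1 :- I :* J) :* (U :+ V :- (w :* U :+ w :* V)) :* c) refl U V I J w c ⟩
      (1# - I * J) * (U + V - (w * U + w * V)) * c
        ≈⟨ *-congʳ (*-congˡ (+-congˡ (-‿cong (+-cong wU wV)))) ⟩
      (1# - I * J) * (U + V - (J * V + Y * U)) * c
        ≈⟨ solve 6 (λ U V I J Y c →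
             (:1 :- I :* J) :* (U :+ V :- (J :* V :+ Y :* U)) :* c :=
             (U :+ V) :* ((:1 :- J) :* (:1 :- Y) :* c) :+
             (J :* (:1 :- I) :* (:1 :- Y) :* (U :* c) :+ (Y :- I :* J) :* (:1 :- J) :* (V :* c)))
             refl U V I J Y c ⟩
      _ ∎

    -- As for `balanced-term`: (1 - w)(U + V) becomes (1 - I)U + (1 - Z)V, and 1 - IJ is split as (1
    -- - Z) + (Z - IJ) in the U term and as (1 - I) + I(1 - J) in the V term.
    skew-term : ∀ U V I J Z w c → w * U ≈ Z * V → w * V ≈ I * U →
      (1# - I * J) * (1# - w) * ((U + V) * c) ≈
      (U + V) * ((1# - I) * (1# - Z) * c) +
        ((Z - I * J) * (1# - I) * (U * c) + I * (1# - J) * (1# - Z) * (V * c))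
    skew-term U V I J Z w c wU wV = begin
      (1# - I * J) * (1# - w) * ((U + V) * c)
        ≈⟨ solve 6 (λ U V I J w c →
             (:1 :- I :* J) :* (:1 :- w) :* ((U :+ V) :* c) :=
             (:1 :- I :* J) :* (U :+ V :- (w :* U :+ w :* V)) :* c) refl U V I J w c ⟩
      (1# - I * J) * (U + V - (w * U + w * V)) * c
        ≈⟨ *-congʳ (*-congˡ (+-congˡ (-‿cong (+-cong wU wV)))) ⟩
      (1# - I * J) * (U + V - (Z * V + I * U)) * c
        ≈⟨ solve 6 (λ U V I J Z c →
             (:1 :- I :* J) :* (U :+ V :- (Z :* V :+ I :* U)) :* c :=
             (U :+ V) :* ((:1 :- I) :* (:1 :- Z) :* c) :+
             ((Z :- I :* J) :* (:1 :- I) :* (U :* c) :+ I :* (:1 :- J) :* (:1 :- Z) :* (V :* c)))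
             refl U V I J Z c ⟩
      _ ∎

    -- The common shape of both recurrences: multiplying by P gives the new summand `g` plus a part
    -- that telescopes away.
    antidiagonal-step : ∀ n P f g a b →
      (∀ i j → i ℕ.+ j ≡ suc n → P * f i j ≈ g i j + (a i j + b i j)) →
      (∀ j → a 0 j ≈ 0#) → (∀ i → b i 0 ≈ 0#) →
      (∀ i j → i ℕ.+ j ≡ n → b i (suc j) + a (suc i) j ≈ 0#) →
      P * antidiagonal (suc n) f ≈ antidiagonal (suc n) g
    antidiagonal-step n P f g a b split a₀ b₀ cancel = begin
      P * antidiagonal (suc n) f
        ≈⟨ antidiagonal-*ˡ (suc n) P f ⟨
      antidiagonal (suc n) (λ i j → P * f i j)
        ≈⟨ antidiagonal-cong (suc n) split ⟩
      antidiagonal (suc n) (λ i j → g i j + (a i j + b i j))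
        ≈⟨ antidiagonal-+ (suc n) g (λ i j → a i j + b i j) ⟩
      antidiagonal (suc n) g + antidiagonal (suc n) (λ i j → a i j + b i j)
        ≈⟨ +-congˡ (antidiagonal-telescope n a b a₀ b₀ cancel) ⟩
      antidiagonal (suc n) g + 0#
        ≈⟨ +-identityʳ _ ⟩
      antidiagonal (suc n) g ∎

    pow-split : ∀ {n} i j → i ℕ.+ j ≡ n → pow (n ℕ.* 10) ≈ pow (i ℕ.* 10) * pow (j ℕ.* 10)
    pow-split i j ≡.refl = trans (reflexive (≡.cong pow (ℕ.*-distribʳ-+ 10 i j))) (pow-+ _ _)

    -- Turns the differences Y - IJ and Z - IJ, after the shift of one index, into a monomial times
    -- a factor that clears a denominator.
    factor-split : ∀ a b {c d} → c ℕ.+ d ≡ a ℕ.+ b → pow a - pow c * pow d ≈ pow a * factor b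
    factor-split a b {c} {d} eq = begin
      pow a - pow c * pow d   ≈⟨ +-congˡ (-‿cong (pow-+ c d)) ⟨
      pow a - pow (c ℕ.+ d)   ≡⟨ ≡.cong (λ e → pow a - pow e) eq ⟩
      pow a - pow (a ℕ.+ b)   ≈⟨ +-congˡ (-‿cong (pow-+ a b)) ⟩
      pow a - pow a * pow b   ≈⟨ solve 2 (λ x y → x :- x :* y := x :* (:1 :- y)) refl _ _ ⟩
      pow a * factor b        ∎

    -- A letter with ⁺ is the reciprocal product with one more factor. The two neighbouring summands
    -- have their longer products in complementary places, and the factors f shorten both to the
    -- same weight.
    opposite-terms : ∀ {x y p p⁺ q q⁺ r r⁺ s s⁺ f₁ f₂ f₃ f₄} → x + y ≈ 0# →
      f₁ * q⁺ ≈ q → f₂ * s⁺ ≈ s → f₃ * p⁺ ≈ p → f₄ * r⁺ ≈ r →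
      x * ((p * (f₁ * q⁺)) * (r * (f₂ * s⁺))) + y * (((f₃ * p⁺) * q) * ((f₄ * r⁺) * s)) ≈ 0#
    opposite-terms {x} {y} {p} {p⁺} {q} {q⁺} {r} {r⁺} {s} {s⁺} x+y≈0 e₁ e₂ e₃ e₄ = begin
      _ ≈⟨ +-cong (*-congˡ (*-cong (*-congˡ e₁) (*-congˡ e₂)))
                  (*-congˡ (*-cong (*-congʳ e₃) (*-congʳ e₄))) ⟩
      x * ((p * q) * (r * s)) + y * ((p * q) * (r * s)) ≈⟨ distribʳ _ x y ⟨
      (x + y) * ((p * q) * (r * s))                     ≈⟨ *-congʳ x+y≈0 ⟩
      0# * ((p * q) * (r * s))                          ≈⟨ zeroˡ _ ⟩
      0# ∎

    balanced-sum skew-sum : ℕ → Carrier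
    balanced-sum m = antidiagonal (m ℕ.* 2) (λ i j → T (i ⊖ m) * balanced i j)
    skew-sum     m = antidiagonal (suc (m ℕ.* 2)) (λ i j → T (i ⊖ suc m) * skew i j)

    ε-⊖ : ∀ i m → ε (suc i ⊖ m) ≈ - ε (i ⊖ m)
    ε-⊖ i m = trans (reflexive (≡.cong ε (⊖-sucˡ i m))) (ε-suc (i ⊖ m))

    -- Lowers a from m + 1 to m. The two prefactors are the last factors of (Q)_(2m+1) and
    -- (Q/x)_(m+1).
    skew-step : ∀ m → factor (suc (m ℕ.* 2) ℕ.* 10) * factor (7 ℕ.+ m ℕ.* 10) * skew-sum m ≈ balanced-sum m
    skew-step m = begin
      factor (suc (m ℕ.* 2) ℕ.* 10) * factor (7 ℕ.+ m ℕ.* 10) * skew-sum m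
        ≈⟨ antidiagonal-step (m ℕ.* 2) _ _ g a b split a₀ b₀ cancel ⟩
      g 0 (suc (m ℕ.* 2)) + antidiagonal (m ℕ.* 2) (g ∘ suc)
        -- The term i = 0 contains 1 - q^0 = 0. The others, reindexed by i + 1, keep their k because
        -- (i + 1) - (m + 1) = i - m.
        ≈⟨ +-cong (trans (*-congˡ (trans (*-congʳ (trans (*-congʳ factor-0) (zeroˡ _))) (zeroˡ _))) (zeroʳ _))
             (antidiagonal-cong (m ℕ.* 2) λ i j _ → shift i j) ⟩
      0# + balanced-sum m
        ≈⟨ +-identityˡ _ ⟩
      balanced-sum m ∎
      where
      k : ℕ → ℤ
      k i = i ⊖ suc m
      g a b : ℕ → ℕ → Carrier
      g i j = T (k i) * (factor (i ℕ.* 10) * factor (4 ℕ.+ j ℕ.* 10) * skew i j)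
      a i j = (pow (4 ℕ.+ j ℕ.* 10) - pow (i ℕ.* 10) * pow (j ℕ.* 10)) * factor (i ℕ.* 10) * (U (k i) * skew i j)
      b i j = pow (i ℕ.* 10) * factor (j ℕ.* 10) * factor (4 ℕ.+ j ℕ.* 10) * (V (k i) * skew i j)

      split : ∀ i j → i ℕ.+ j ≡ suc (m ℕ.* 2) →
        factor (suc (m ℕ.* 2) ℕ.* 10) * factor (7 ℕ.+ m ℕ.* 10) * (T (k i) * skew i j) ≈ g i j + (a i j + b i j)
      split i j eq = trans (*-congʳ (*-congʳ (+-congˡ (-‿cong (pow-split i j eq)))))
        (skew-term _ _ _ _ _ _ _
          (pow-relation (ε (k i)) (skew-u m i j eq)) (pow-relation (ε (k i)) (skew-v m i j eq)))

      a₀ : ∀ j → a 0 j ≈ 0#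
      a₀ j = trans (*-congʳ (trans (*-congˡ factor-0) (zeroʳ _))) (zeroˡ _)

      b₀ : ∀ i → b i 0 ≈ 0#
      b₀ i = trans (*-congʳ (trans (*-congʳ (trans (*-congˡ factor-0) (zeroʳ _))) (zeroˡ _))) (zeroˡ _)

      cancel : ∀ i j → i ℕ.+ j ≡ m ℕ.* 2 → b i (suc j) + a (suc i) j ≈ 0#
      cancel i j eq = begin
        b i (suc j) + a (suc i) j
          ≈⟨ +-congˡ (*-congʳ (*-congʳ (factor-split (4 ℕ.+ j ℕ.* 10) (6 ℕ.+ i ℕ.* 10) (exponent i j)))) ⟩
        b i (suc j) + pow (4 ℕ.+ j ℕ.* 10) * factor (6 ℕ.+ i ℕ.* 10) * factor (suc i ℕ.* 10) * (U (k (suc i)) * skew (suc i) j)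
          ≈⟨ +-cong
              (solve 8 (λ x f₁ f₂ V p q r s → x :* f₁ :* f₂ :* (V :* ((p :* q) :* (r :* s))) :=
                 (x :* V) :* ((p :* (f₁ :* q)) :* (r :* (f₂ :* s)))) refl _ _ _ _ _ _ _ _)
              (solve 8 (λ y f₄ f₃ U p q r s → y :* f₄ :* f₃ :* (U :* ((p :* q) :* (r :* s))) :=
                 (y :* U) :* (((f₃ :* p) :* q) :* ((f₄ :* r) :* s))) refl _ _ _ _ _ _ _ _) ⟩
        _ ≈⟨ opposite-terms
               (pow-opposite (ε (k i)) (ε (k (suc i))) (ε-⊖ i (suc m)) (skew-shift m i j eq))
               (recip-suc 9 j) (recip-suc 3 (suc j)) (recip-suc 9 i) (recip-suc 5 i) ⟩
        0# ∎
        where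
        exponent : ∀ i j → suc i ℕ.* 10 ℕ.+ j ℕ.* 10 ≡ (4 ℕ.+ j ℕ.* 10) ℕ.+ (6 ℕ.+ i ℕ.* 10)
        exponent = ℕ-Ring.solve-∀

      shift : ∀ i j → g (suc i) j ≈ T (i ⊖ m) * balanced i j
      shift i j = *-cong (reflexive (≡.cong T (ℤ.[1+m]⊖[1+n]≡m⊖n i m))) (trans
        (solve 6 (λ f₁ f₂ p q r s → f₁ :* f₂ :* ((p :* q) :* (r :* s)) := ((f₁ :* p) :* q) :* (r :* (f₂ :* s)))
          refl _ _ _ _ _ _)
        (*-cong (*-congʳ (recip-suc 9 i)) (*-congˡ (recip-suc 3 j))))

    -- Lowers b from m + 1 to m while a stays m + 1. The two prefactors are the last factors of
    -- (Q)_(2m+2) and (x)_(m+2).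
    balanced-step : ∀ m →
      factor (suc m ℕ.* 2 ℕ.* 10) * factor (3 ℕ.+ suc m ℕ.* 10) * balanced-sum (suc m) ≈ skew-sum m
    balanced-step m = begin
      factor (suc m ℕ.* 2 ℕ.* 10) * factor (3 ℕ.+ suc m ℕ.* 10) * balanced-sum (suc m)
        ≈⟨ antidiagonal-step (suc (m ℕ.* 2)) _ _ g a b split a₀ b₀ cancel ⟩
      antidiagonal (suc (suc (m ℕ.* 2))) g
        -- Now the vanishing term is the one with j = 0, so the sum is peeled at its other end.
        ≈⟨ antidiagonal-last (suc (m ℕ.* 2)) g ⟩
      antidiagonal (suc (m ℕ.* 2)) (λ i j → g i (suc j)) + g (suc (suc (m ℕ.* 2))) 0
        ≈⟨ +-cong (antidiagonal-cong (suc (m ℕ.* 2)) λ i j _ → *-congˡ {T (k i)} (shift i j))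
             (trans (*-congˡ (trans (*-congʳ (trans (*-congʳ factor-0) (zeroˡ _))) (zeroˡ _))) (zeroʳ _)) ⟩
      skew-sum m + 0#
        ≈⟨ +-identityʳ _ ⟩
      skew-sum m ∎
      where
      k : ℕ → ℤ
      k i = i ⊖ suc m
      g a b : ℕ → ℕ → Carrier
      g i j = T (k i) * (factor (j ℕ.* 10) * factor (6 ℕ.+ i ℕ.* 10) * balanced i j)
      a i j = pow (j ℕ.* 10) * factor (i ℕ.* 10) * factor (6 ℕ.+ i ℕ.* 10) * (U (k i) * balanced i j)
      b i j = (pow (6 ℕ.+ i ℕ.* 10) - pow (i ℕ.* 10) * pow (j ℕ.* 10)) * factor (j ℕ.* 10) * (V (k i) * balanced i j)

      split : ∀ i j → i ℕ.+ j ≡ suc m ℕ.* 2 →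
        factor (suc m ℕ.* 2 ℕ.* 10) * factor (3 ℕ.+ suc m ℕ.* 10) * (T (k i) * balanced i j) ≈ g i j + (a i j + b i j)
      split i j eq = trans (*-congʳ (*-congʳ (+-congˡ (-‿cong (pow-split i j eq)))))
        (balanced-term _ _ _ _ _ _ _
          (pow-relation (ε (k i)) (balanced-u (suc m) i j eq)) (pow-relation (ε (k i)) (balanced-v (suc m) i j eq)))

      a₀ : ∀ j → a 0 j ≈ 0#
      a₀ j = trans (*-congʳ (trans (*-congʳ (trans (*-congˡ factor-0) (zeroʳ _))) (zeroˡ _))) (zeroˡ _)

      b₀ : ∀ i → b i 0 ≈ 0#
      b₀ i = trans (*-congʳ (trans (*-congˡ factor-0) (zeroʳ _))) (zeroˡ _)

      cancel : ∀ i j → i ℕ.+ j ≡ suc (m ℕ.* 2) → b i (suc j) + a (suc i) j ≈ 0#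
      cancel i j eq = begin
        b i (suc j) + a (suc i) j
          ≈⟨ +-congʳ (*-congʳ (*-congʳ (factor-split (6 ℕ.+ i ℕ.* 10) (4 ℕ.+ j ℕ.* 10) (exponent i j)))) ⟩
        pow (6 ℕ.+ i ℕ.* 10) * factor (4 ℕ.+ j ℕ.* 10) * factor (suc j ℕ.* 10) * (V (k i) * balanced i (suc j)) + a (suc i) j
          ≈⟨ +-cong
              (solve 8 (λ x f₂ f₁ V p q r s → x :* f₂ :* f₁ :* (V :* ((p :* q) :* (r :* s))) :=
                 (x :* V) :* ((p :* (f₁ :* q)) :* (r :* (f₂ :* s)))) refl _ _ _ _ _ _ _ _)
              (solve 8 (λ y f₃ f₄ U p q r s → y :* f₃ :* f₄ :* (U :* ((p :* q) :* (r :* s))) :=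
                 (y :* U) :* (((f₃ :* p) :* q) :* ((f₄ :* r) :* s))) refl _ _ _ _ _ _ _ _) ⟩
        _ ≈⟨ opposite-terms
               (pow-opposite (ε (k i)) (ε (k (suc i))) (ε-⊖ i (suc m))
                 (balanced-shift (suc m) i j (≡.trans (ℕ.+-suc i j) (≡.cong suc eq))))
               (recip-suc 9 j) (recip-suc 3 j) (recip-suc 9 i) (recip-suc 5 (suc i)) ⟩
        0# ∎
        where
        exponent : ∀ i j → i ℕ.* 10 ℕ.+ suc j ℕ.* 10 ≡ (6 ℕ.+ i ℕ.* 10) ℕ.+ (4 ℕ.+ j ℕ.* 10)
        exponent = ℕ-Ring.solve-∀

      shift : ∀ i j → factor (suc j ℕ.* 10) * factor (6 ℕ.+ i ℕ.* 10) * balanced i (suc j) ≈ skew i j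
      shift i j = trans
        (solve 6 (λ f₁ f₂ p q r s → f₁ :* f₂ :* ((p :* q) :* (r :* s)) := (p :* (f₁ :* q)) :* ((f₂ :* r) :* s))
          refl _ _ _ _ _ _)
        (*-cong (*-congˡ (recip-suc 9 j)) (*-congʳ (recip-suc 5 i)))

    cancel-factors : ∀ d e {x y} → factor (suc d) * factor (suc e) * x ≈ factor (suc d) * factor (suc e) * y → x ≈ y
    cancel-factors d e eq = cancel-factor e (cancel-factor d
      (trans (sym (*-assoc _ _ _)) (trans eq (*-assoc _ _ _))))

    -- Only k = 0 occurs, and (1 + q³) / (1 - q⁶) = 1 / (1 - q³).
    balanced-base : balanced-sum 0 ≈ recip 10 0 * (recip 3 1 * recip 7 0)
    balanced-base = cancel-factors 2 5 (begin
      factor 3 * factor 6 * balanced-sum 0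
        ≈⟨ solve 5 (λ f₃ f₆ p₀ p₃ i₆ → f₃ :* f₆ :* ((:1 :* p₀ :+ :1 :* p₃) :* ((:1 :* :1) :* ((:1 :* i₆) :* :1)))
              := f₃ :* (p₀ :+ p₃) :* (f₆ :* (:1 :* i₆))) refl _ _ _ _ _ ⟩
      factor 3 * (pow 0 + pow 3) * (factor 6 * recip 6 1)
        ≈⟨ *-cong (*-congˡ (+-congʳ pow-0)) (recip-suc 5 0) ⟩
      factor 3 * (1# + pow 3) * 1#
        ≈⟨ solve 1 (λ x → (:1 :- x) :* (:1 :+ x) :* :1 := :1 :- x :* x) refl _ ⟩
      1# - pow 3 * pow 3
        ≈⟨ +-congˡ (-‿cong (pow-+ 3 3)) ⟨
      factor 6
        ≈⟨ *-identityʳ _ ⟨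
      factor 6 * 1#
        ≈⟨ *-congˡ (recip-suc 2 0) ⟨
      factor 6 * (factor 3 * recip 3 1)
        ≈⟨ solve 3 (λ a b c → a :* (b :* c) := b :* a :* (:1 :* (c :* :1))) refl _ _ _ ⟩
      factor 3 * factor 6 * (recip 10 0 * (recip 3 1 * recip 7 0)) ∎)

    -- Mutual induction along (m,m), (m+1,m), (m+1,m+1): each recurrence multiplies the sum by two
    -- factors that also clear the last denominators on the right, and these factors are invertible.
    balanced-identity : ∀ m → balanced-sum m ≈ recip 10 (m ℕ.* 2) * (recip 3 (suc m) * recip 7 m)
    skew-identity : ∀ m → skew-sum m ≈ recip 10 (suc (m ℕ.* 2)) * (recip 3 (suc m) * recip 7 (suc m))

    balanced-identity zero    = balanced-base
    balanced-identity (suc m) = cancel-factors _ _ (begin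
      factor (suc m ℕ.* 2 ℕ.* 10) * factor (3 ℕ.+ suc m ℕ.* 10) * balanced-sum (suc m)
        ≈⟨ balanced-step m ⟩
      skew-sum m
        ≈⟨ skew-identity m ⟩
      recip 10 (suc (m ℕ.* 2)) * (recip 3 (suc m) * recip 7 (suc m))
        ≈⟨ *-cong (recip-suc 9 (suc (m ℕ.* 2))) (*-congʳ (recip-suc 2 (suc m))) ⟨
      _ ≈⟨ solve 5 (λ f₁ f₂ p q r → (f₁ :* p) :* ((f₂ :* q) :* r) := f₁ :* f₂ :* (p :* (q :* r))) refl _ _ _ _ _ ⟩
      factor (suc m ℕ.* 2 ℕ.* 10) * factor (3 ℕ.+ suc m ℕ.* 10) *
        (recip 10 (suc m ℕ.* 2) * (recip 3 (suc (suc m)) * recip 7 (suc m))) ∎)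

    skew-identity m = cancel-factors _ _ (begin
      factor (suc (m ℕ.* 2) ℕ.* 10) * factor (7 ℕ.+ m ℕ.* 10) * skew-sum m
        ≈⟨ skew-step m ⟩
      balanced-sum m
        ≈⟨ balanced-identity m ⟩
      recip 10 (m ℕ.* 2) * (recip 3 (suc m) * recip 7 m)
        ≈⟨ *-cong (recip-suc 9 (m ℕ.* 2)) (*-congˡ (recip-suc 6 m)) ⟨
      _ ≈⟨ solve 5 (λ f₁ f₂ p q r → (f₁ :* p) :* (q :* (f₂ :* r)) := f₁ :* f₂ :* (p :* (q :* r))) refl _ _ _ _ _ ⟩
      factor (suc (m ℕ.* 2) ℕ.* 10) * factor (7 ℕ.+ m ℕ.* 10) *
        (recip 10 (suc (m ℕ.* 2)) * (recip 3 (suc m) * recip 7 (suc m))) ∎)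

    -- Passage to infinite products when q^e = 0 for all e > N.

    module Nilpotent (N : ℕ) (pow-large : ∀ e → N < e → pow e ≈ 0#) where

      factor-large : ∀ e → N < e → factor e ≈ 1#
      factor-large e N<e = trans (+-congˡ (-‿cong (pow-large e N<e))) (solve 0 (:1 :- :0 := :1) refl)

      inv-large : ∀ e → N < e → inv e ≈ 1#
      inv-large (suc e) N<e = begin
        inv (suc e)                      ≈⟨ *-identityʳ _ ⟨
        inv (suc e) * 1#                 ≈⟨ *-congˡ (factor-large (suc e) N<e) ⟨
        inv (suc e) * (1# - pow (suc e)) ≈⟨ inverse e ⟩
        1#                               ∎

      module Progressions (h : ℕ → Carrier) (h-large : ∀ e → N < e → h e ≈ 1#) where

        -- For positive b every factor with i > N is 1, so N + 1 factors make up the whole infinite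
        -- product.
        total : ℕ → ℕ → Carrier
        total a b = ∏ (suc N) (λ i → h (a ℕ.+ i ℕ.* b))

        total-limit : ∀ a b {n} → N < n → ∏ n (λ i → h (a ℕ.+ i ℕ.* suc b)) ≈ total a (suc b)
        total-limit a b = ∏-stable N
          (λ i N<i → h-large _ (ℕ.<-≤-trans N<i (ℕ.≤-trans (ℕ.m≤m*n i (suc b)) (ℕ.m≤n+m _ a)))) _

        -- Lengthening the product to (N + 1)(d + 1) factors changes nothing and gives each residue
        -- class of the index exactly N + 1 of them.
        sections : ∀ d a b →
          total a (suc b) ≈ ∏ (suc d) (λ r → total (a ℕ.+ r ℕ.* suc b) (suc d ℕ.* suc b))
        sections d a b = begin
          total a (suc b)
            ≈⟨ total-limit a b (ℕ.m≤m*n (suc N) (suc d)) ⟨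
          ∏ (suc N ℕ.* suc d) f
            ≈⟨ ∏-sections (suc d) (suc N) f ⟩
          ∏ (suc d) (λ r → ∏ (suc N) (λ i → f (r ℕ.+ i ℕ.* suc d)))
            ≈⟨ ∏-cong (suc d) (λ r → ∏-cong (suc N) λ i → reflexive (≡.cong h (exponent a b d r i))) ⟩
          ∏ (suc d) (λ r → total (a ℕ.+ r ℕ.* suc b) (suc d ℕ.* suc b)) ∎
          where
          f : ℕ → Carrier
          f i = h (a ℕ.+ i ℕ.* suc b)
          exponent : ∀ a b d r i → a ℕ.+ (r ℕ.+ i ℕ.* suc d) ℕ.* suc b ≡
            a ℕ.+ r ℕ.* suc b ℕ.+ i ℕ.* (suc d ℕ.* suc b)
          exponent = ℕ-Ring.solve-∀

      -- P a b = (q^a ; q^b)_∞ and I a b = 1 / (q^a ; q^b)_∞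
      open Progressions factor factor-large public using ()
        renaming (total to P; sections to P-sections)
      open Progressions inv inv-large public using ()
        renaming (total to I; total-limit to I-limit; sections to I-sections)

      P*I≈1 : ∀ a b → P (suc a) b * I (suc a) b ≈ 1#
      P*I≈1 a b = trans (sym (∏-* (suc N) _ _)) (∏-1 (suc N) λ i → trans (*-comm _ _) (inverse (a ℕ.+ i ℕ.* b)))

      T-large : ∀ k → N < ℤ.∣ k ∣ → T k ≈ 0#
      T-large k N<k = trans
        (+-cong (*-congˡ (pow-large _ (ℕ.<-≤-trans N<k (∣k∣≤u k)))) (*-congˡ (pow-large _ (ℕ.<-≤-trans N<k (∣k∣≤v k)))))
        (solve 1 (λ x → x :* :0 :+ x :* :0 := :0) refl (ε k))

      -- The partial theta series with k running from -(m + 1) to m.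
      theta : ℕ → Carrier
      theta m = antidiagonal (suc (m ℕ.* 2)) (λ i _ → T (i ⊖ suc m))

      -- Raising m adds one term at each end, so k = j is paired with k = -1 - j. This is the
      -- grouping in which the exponents are enumerated later.
      theta-∑ : ∀ m → theta m ≈ ∑ m (λ j → T (+ j) + T -[1+ j ])
      theta-∑ zero    = +-comm _ _
      theta-∑ (suc m) = begin
        T -[1+ suc m ] + antidiagonal (suc (suc (m ℕ.* 2))) (λ i _ → T (suc i ⊖ suc (suc m)))
          ≈⟨ +-congˡ (antidiagonal-cong (suc (suc (m ℕ.* 2))) {g = λ i _ → T (i ⊖ suc m)}
               λ i _ _ → reflexive (≡.cong T (ℤ.[1+m]⊖[1+n]≡m⊖n i (suc m)))) ⟩
        T -[1+ suc m ] + antidiagonal (suc (suc (m ℕ.* 2))) (λ i _ → T (i ⊖ suc m))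
          ≈⟨ +-congˡ (antidiagonal-last (suc (m ℕ.* 2)) (λ i _ → T (i ⊖ suc m))) ⟩
        T -[1+ suc m ] + (theta m + T (suc (suc (m ℕ.* 2)) ⊖ suc m))
          ≈⟨ +-congˡ (+-cong (theta-∑ m) (reflexive (≡.cong T last-index))) ⟩
        T -[1+ suc m ] + (∑ m (λ j → T (+ j) + T -[1+ j ]) + T (+ suc m))
          ≈⟨ solve 3 (λ x y z → x :+ (y :+ z) := y :+ (z :+ x)) refl _ _ _ ⟩
        ∑ m (λ j → T (+ j) + T -[1+ j ]) + (T (+ suc m) + T -[1+ suc m ]) ∎
        where
        double : ∀ m → suc (suc (m ℕ.* 2)) ≡ suc m ℕ.+ suc m
        double = ℕ-Ring.solve-∀
        last-index : suc (suc (m ℕ.* 2)) ⊖ suc m ≡ + suc m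
        last-index = ≡.trans (≡.cong (_⊖ suc m) (double m))
          (≡.trans (ℤ.⊖-≥ (ℕ.m≤m+n (suc m) (suc m))) (≡.cong +_ (ℕ.m+n∸m≡n (suc m) (suc m))))

      -- Every term of `skew-sum M` either vanishes or has attained its limiting weight.
      M : ℕ
      M = suc (N ℕ.+ N)

      weight : Carrier
      weight = (I 10 10 * I 10 10) * (I 6 10 * I 4 10)

      both-zero : ∀ {t x y} → t ≈ 0# → t * x ≈ t * y
      both-zero t≈0 = trans (*-congʳ t≈0) (trans (zeroˡ _) (sym (trans (*-congʳ t≈0) (zeroˡ _))))

      -- If i and j both exceed N, all four reciprocal products are complete. Otherwise T vanishes:
      -- with M = 2N + 1, i ≤ N forces k ≤ -(N + 2) and j ≤ N forces k ≥ N + 1.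
      skew-limit : ∀ i j → i ℕ.+ j ≡ suc (M ℕ.* 2) → T (i ⊖ suc M) * skew i j ≈ T (i ⊖ suc M) * weight
      skew-limit i j eq with N ℕ.<? i | N ℕ.<? j
      ... | yes N<i | yes N<j = *-congˡ (*-cong (*-cong (I-limit 10 9 N<i) (I-limit 10 9 N<j))
                                  (*-cong (I-limit 6 9 N<i) (I-limit 4 9 (ℕ.m<n⇒m<1+n N<j))))
      ... | no  N≮i | _ = both-zero (T-large (i ⊖ suc M) (≡.subst (N <_)
          (≡.sym (ℤ.∣⊖∣-≤ (ℕ.m+n≤o⇒n≤o (suc N) gap)))
          (ℕ.m+n≤o⇒m≤o∸n (suc N) gap)))
        where
        gap : suc N ℕ.+ i ≤ suc M
        gap = ℕ.≤-trans (ℕ.+-monoʳ-≤ (suc N) (ℕ.≮⇒≥ N≮i)) (ℕ.n≤1+n _)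
      ... | _ | no N≮j = both-zero (T-large (i ⊖ suc M) (≡.subst (N <_)
          (≡.sym (≡.trans (ℤ.∣m⊖n∣≡∣n⊖m∣ i (suc M)) (ℤ.∣⊖∣-≤ (ℕ.m+n≤o⇒n≤o (suc N) gap))))
          (ℕ.m+n≤o⇒m≤o∸n (suc N) gap)))
        where
        total-index : ∀ N → suc N ℕ.+ suc (suc (N ℕ.+ N)) ℕ.+ N ≡ suc (suc (N ℕ.+ N) ℕ.* 2)
        total-index = ℕ-Ring.solve-∀
        gap : suc N ℕ.+ suc M ≤ i
        gap = ℕ.+-cancelʳ-≤ j _ _ (ℕ.≤-trans (ℕ.+-monoʳ-≤ (suc N ℕ.+ suc M) (ℕ.≮⇒≥ N≮j))
                (ℕ.≤-reflexive (≡.trans (total-index N) (≡.sym eq))))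

      theta-weighted : theta M * weight ≈ I 10 10 * (I 3 10 * I 7 10)
      theta-weighted = begin
        theta M * weight
          ≈⟨ antidiagonal-*ʳ (suc (M ℕ.* 2)) (λ i _ → T (i ⊖ suc M)) weight ⟨
        antidiagonal (suc (M ℕ.* 2)) (λ i _ → T (i ⊖ suc M) * weight)
          ≈⟨ antidiagonal-cong (suc (M ℕ.* 2)) skew-limit ⟨
        skew-sum M
          ≈⟨ skew-identity M ⟩
        recip 10 (suc (M ℕ.* 2)) * (recip 3 (suc M) * recip 7 (suc M))
          ≈⟨ *-cong (I-limit 10 9 (s≤s (ℕ.≤-trans N≤M (ℕ.m≤m*n M 2))))
                    (*-cong (I-limit 3 9 (s≤s N≤M)) (I-limit 7 9 (s≤s N≤M))) ⟩
        I 10 10 * (I 3 10 * I 7 10) ∎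
        where
        N≤M : N ≤ M
        N≤M = ℕ.m≤n⇒m≤1+n (ℕ.m≤m+n N N)

      -- The weight is removed by inserting P · I = 1 for each of its four factors. One of the two
      -- copies of (Q;Q)_∞ that this leaves cancels against `I 10 10`.
      quintuple-product : theta M ≈ P 10 10 * (P 6 10 * P 4 10) * (I 3 10 * I 7 10)
      quintuple-product = begin
        theta M
          ≈⟨ solve 1 (λ t → t := t :* ((:1 :* :1) :* (:1 :* :1))) refl _ ⟩
        theta M * ((1# * 1#) * (1# * 1#))
          ≈⟨ *-congˡ (*-cong (*-cong (P*I≈1 9 10) (P*I≈1 9 10)) (*-cong (P*I≈1 5 10) (P*I≈1 3 10))) ⟨
        theta M * (((P 10 10 * I 10 10) * (P 10 10 * I 10 10)) * ((P 6 10 * I 6 10) * (P 4 10 * I 4 10)))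
          ≈⟨ solve 7 (λ t p i p₆ i₆ p₄ i₄ →
               t :* (((p :* i) :* (p :* i)) :* ((p₆ :* i₆) :* (p₄ :* i₄))) :=
               (t :* ((i :* i) :* (i₆ :* i₄))) :* ((p :* p) :* (p₆ :* p₄))) refl _ _ _ _ _ _ _ ⟩
        (theta M * weight) * ((P 10 10 * P 10 10) * (P 6 10 * P 4 10))
          ≈⟨ *-congʳ theta-weighted ⟩
        (I 10 10 * (I 3 10 * I 7 10)) * ((P 10 10 * P 10 10) * (P 6 10 * P 4 10))
          ≈⟨ solve 4 (λ p i x y → (i :* y) :* ((p :* p) :* x) := (p :* i) :* (p :* x :* y)) refl _ _ _ _ ⟩
        (P 10 10 * I 10 10) * (P 10 10 * (P 6 10 * P 4 10) * (I 3 10 * I 7 10))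
          ≈⟨ trans (*-congʳ (P*I≈1 9 10)) (*-identityˡ _) ⟩
        P 10 10 * (P 6 10 * P 4 10) * (I 3 10 * I 7 10) ∎

      -- Both sides are (q² ; q²)_∞.
      numerator : P 2 8 * P 6 8 * P 8 8 * P 4 16 * P 12 16 ≈ P 2 10 * P 4 10 * P 6 10 * P 8 10 * P 10 10
      numerator = begin
        P 2 8 * P 6 8 * P 8 8 * P 4 16 * P 12 16
          ≈⟨ solve 5 (λ a b c d e → a :* b :* c :* d :* e := :1 :* (:1 :* a :* b) :* (:1 :* (:1 :* d :* e) :* c))
               refl _ _ _ _ _ ⟩
        1# * (1# * P 2 8 * P 6 8) * (1# * (1# * P 4 16 * P 12 16) * P 8 8)
          ≈⟨ *-cong (*-congˡ (P-sections 1 2 3)) (*-congʳ (*-congˡ (P-sections 1 4 7))) ⟨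
        1# * P 2 4 * (1# * P 4 8 * P 8 8)
          ≈⟨ *-congˡ (P-sections 1 4 3) ⟨
        1# * P 2 4 * P 4 4
          ≈⟨ P-sections 1 2 1 ⟨
        P 2 2
          ≈⟨ P-sections 4 2 1 ⟩
        1# * P 2 10 * P 4 10 * P 6 10 * P 8 10 * P 10 10
          ≈⟨ *-congʳ (*-congʳ (*-congʳ (*-congʳ (*-identityˡ _)))) ⟩
        P 2 10 * P 4 10 * P 6 10 * P 8 10 * P 10 10 ∎

      -- The factors are parameters so that the series of the statement can be substituted. Modulo
      -- 10, the denominator (q²,q³;q⁵) has the classes 2, 7, 3, 8, of which 2 and 8 cancel against
      -- the numerator.
      theta-product : ∀ {p₂ p₆ p₈ p₄ p₁₂ i₂ i₃} →
        p₂ ≈ P 2 8 → p₆ ≈ P 6 8 → p₈ ≈ P 8 8 → p₄ ≈ P 4 16 → p₁₂ ≈ P 12 16 → i₂ ≈ I 2 5 → i₃ ≈ I 3 5 →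
        theta M ≈ p₂ * p₆ * p₈ * p₄ * p₁₂ * i₂ * i₃
      theta-product {p₂} {p₆} {p₈} {p₄} {p₁₂} {i₂} {i₃} e₁ e₂ e₃ e₄ e₅ e₆ e₇ = sym (begin
        p₂ * p₆ * p₈ * p₄ * p₁₂ * i₂ * i₃
          ≈⟨ *-cong (*-cong (*-cong (*-cong (*-cong (*-cong e₁ e₂) e₃) e₄) e₅) e₆) e₇ ⟩
        P 2 8 * P 6 8 * P 8 8 * P 4 16 * P 12 16 * I 2 5 * I 3 5
          ≈⟨ *-cong (*-cong numerator (I-sections 1 2 4)) (I-sections 1 3 4) ⟩
        P 2 10 * P 4 10 * P 6 10 * P 8 10 * P 10 10 * (1# * I 2 10 * I 7 10) * (1# * I 3 10 * I 8 10)
          ≈⟨ solve 9 (λ a b c d e w x y z →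
               a :* b :* c :* d :* e :* (:1 :* w :* x) :* (:1 :* y :* z) :=
               (a :* w) :* (d :* z) :* (e :* (c :* b) :* (y :* x))) refl _ _ _ _ _ _ _ _ _ ⟩
        (P 2 10 * I 2 10) * (P 8 10 * I 8 10) * (P 10 10 * (P 6 10 * P 4 10) * (I 3 10 * I 7 10))
          ≈⟨ *-congʳ (*-cong (P*I≈1 1 10) (P*I≈1 7 10)) ⟩
        1# * 1# * (P 10 10 * (P 6 10 * P 4 10) * (I 3 10 * I 7 10))
          ≈⟨ solve 1 (λ x → :1 :* :1 :* x := x) refl _ ⟩
        P 10 10 * (P 6 10 * P 4 10) * (I 3 10 * I 7 10)
          ≈⟨ quintuple-product ⟨
        theta M ∎)

-- Power series

Σ≤-cong : ∀ n {f g} → (∀ i → i ≤ n → f i ≡ g i) → Σ≤ n f ≡ Σ≤ n g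
Σ≤-cong zero    h = h 0 z≤n
Σ≤-cong (suc n) h = ≡.cong₂ ℤ._+_ (Σ≤-cong n λ i i≤n → h i (ℕ.m≤n⇒m≤1+n i≤n)) (h (suc n) ℕ.≤-refl)

Σ≤-head : ∀ n f → Σ≤ (suc n) f ≡ f 0 ℤ.+ Σ≤ n (f ∘ suc)
Σ≤-head zero    f = ≡.refl
Σ≤-head (suc n) f = ≡.trans (≡.cong (ℤ._+ f (suc (suc n))) (Σ≤-head n f)) (ℤ.+-assoc (f 0) _ _)

Σ≤-+ : ∀ n f g → Σ≤ n (λ i → f i ℤ.+ g i) ≡ Σ≤ n f ℤ.+ Σ≤ n g
Σ≤-+ zero    f g = ≡.refl
Σ≤-+ (suc n) f g = ≡.trans (≡.cong (ℤ._+ (f (suc n) ℤ.+ g (suc n))) (Σ≤-+ n f g)) (lemma (Σ≤ n f) (Σ≤ n g) (f (suc n)) (g (suc n)))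
  where
  lemma : ∀ a b c d → (a ℤ.+ b) ℤ.+ (c ℤ.+ d) ≡ (a ℤ.+ c) ℤ.+ (b ℤ.+ d)
  lemma = ℤ-Ring.solve-∀

Σ≤-*ˡ : ∀ n x f → Σ≤ n (λ i → x ℤ.* f i) ≡ x ℤ.* Σ≤ n f
Σ≤-*ˡ zero    x f = ≡.refl
Σ≤-*ˡ (suc n) x f = ≡.trans (≡.cong (ℤ._+ (x ℤ.* f (suc n))) (Σ≤-*ˡ n x f)) (≡.sym (ℤ.*-distribˡ-+ x _ _))

Σ≤-zero : ∀ n f → (∀ i → i ≤ n → f i ≡ + 0) → Σ≤ n f ≡ + 0
Σ≤-zero zero    f h = h 0 z≤n
Σ≤-zero (suc n) f h = ≡.cong₂ ℤ._+_ (Σ≤-zero n f λ i i≤n → h i (ℕ.m≤n⇒m≤1+n i≤n)) (h (suc n) ℕ.≤-refl)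

infixl 6 _⊕_
_⊕_ : PS → PS → PS
(f ⊕ g) n = f n ℤ.+ g n

⊝_ : PS → PS
(⊝ f) n = ℤ.- f n

const : ℤ → PS
const c zero    = c
const c (suc _) = + 0

mono : ℕ → PS
mono k n = if n ≡ᵇ k then + 1 else + 0

⊛-cong : ∀ n {f f′ g g′} → (∀ i → i ≤ n → f i ≡ f′ i) → (∀ i → i ≤ n → g i ≡ g′ i) →
  (f ⊛ g) n ≡ (f′ ⊛ g′) n
⊛-cong n p q = Σ≤-cong n λ i i≤n → ≡.cong₂ ℤ._*_ (p i i≤n) (q (n ∸ i) (ℕ.m∸n≤m n i))

⊛-congʳ : ∀ {f f′} g n → (∀ i → f i ≡ f′ i) → (f ⊛ g) n ≡ (f′ ⊛ g) n
⊛-congʳ g n p = ⊛-cong n {g = g} (λ i _ → p i) (λ _ _ → ≡.refl)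

⊛-suc : ∀ f g n → (f ⊛ g) (suc n) ≡ f 0 ℤ.* g (suc n) ℤ.+ ((f ∘ suc) ⊛ g) n
⊛-suc f g n = Σ≤-head n _

⊛-suc′ : ∀ f g n → (f ⊛ g) (suc n) ≡ (f ⊛ (g ∘ suc)) n ℤ.+ f (suc n) ℤ.* g 0
⊛-suc′ f g n = ≡.cong₂ ℤ._+_
  (Σ≤-cong n λ i i≤n → ≡.cong (λ d → f i ℤ.* g d) (ℕ.+-∸-assoc 1 i≤n))
  (≡.cong (λ d → f (suc n) ℤ.* g d) (ℕ.n∸n≡0 n))

⊛-comm : ∀ f g n → (f ⊛ g) n ≡ (g ⊛ f) n
⊛-comm f g zero    = ℤ.*-comm (f 0) (g 0)
⊛-comm f g (suc n) = begin
  (f ⊛ g) (suc n)                              ≡⟨ ⊛-suc f g n ⟩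
  f 0 ℤ.* g (suc n) ℤ.+ ((f ∘ suc) ⊛ g) n      ≡⟨ ≡.cong₂ ℤ._+_ (ℤ.*-comm (f 0) _) (⊛-comm (f ∘ suc) g n) ⟩
  g (suc n) ℤ.* f 0 ℤ.+ (g ⊛ (f ∘ suc)) n      ≡⟨ ℤ.+-comm (g (suc n) ℤ.* f 0) _ ⟩
  (g ⊛ (f ∘ suc)) n ℤ.+ g (suc n) ℤ.* f 0      ≡⟨ ⊛-suc′ g f n ⟨
  (g ⊛ f) (suc n)                              ∎
  where open ≡.≡-Reasoning

⊛-distribʳ : ∀ h f g n → ((f ⊕ g) ⊛ h) n ≡ (f ⊛ h ⊕ g ⊛ h) n
⊛-distribʳ h f g n = ≡.trans (Σ≤-cong n λ i _ → ℤ.*-distribʳ-+ (h (n ∸ i)) (f i) (g i)) (Σ≤-+ n _ _)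

⊛-scale : ∀ x f g n → ((λ i → x ℤ.* f i) ⊛ g) n ≡ x ℤ.* (f ⊛ g) n
⊛-scale x f g n = ≡.trans (Σ≤-cong n λ i _ → ℤ.*-assoc x (f i) _) (Σ≤-*ˡ n x _)

-- Induction on the degree for all f at once: the shift of f ⊛ g is f 0 times the shift of g plus
-- (shift of f) ⊛ g, and the hypothesis applies to the shift of f.
⊛-assoc : ∀ f g h n → ((f ⊛ g) ⊛ h) n ≡ (f ⊛ (g ⊛ h)) n
⊛-assoc f g h zero    = ℤ.*-assoc (f 0) (g 0) (h 0)
⊛-assoc f g h (suc n) = begin
  ((f ⊛ g) ⊛ h) (suc n)
    ≡⟨ ⊛-suc (f ⊛ g) h n ⟩
  f 0 ℤ.* g 0 ℤ.* h (suc n) ℤ.+ (((f ⊛ g) ∘ suc) ⊛ h) n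
    ≡⟨ ≡.cong (ℤ._+_ (f 0 ℤ.* g 0 ℤ.* h (suc n))) (begin
         (((f ⊛ g) ∘ suc) ⊛ h) n
           ≡⟨ ⊛-congʳ h n (⊛-suc f g) ⟩
         (((λ i → f 0 ℤ.* g (suc i)) ⊕ (f ∘ suc) ⊛ g) ⊛ h) n
           ≡⟨ ⊛-distribʳ h (λ i → f 0 ℤ.* g (suc i)) ((f ∘ suc) ⊛ g) n ⟩
         ((λ i → f 0 ℤ.* g (suc i)) ⊛ h) n ℤ.+ (((f ∘ suc) ⊛ g) ⊛ h) n
           ≡⟨ ≡.cong₂ ℤ._+_ (⊛-scale (f 0) (g ∘ suc) h n) (⊛-assoc (f ∘ suc) g h n) ⟩
         f 0 ℤ.* ((g ∘ suc) ⊛ h) n ℤ.+ ((f ∘ suc) ⊛ (g ⊛ h)) n ∎) ⟩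
  f 0 ℤ.* g 0 ℤ.* h (suc n) ℤ.+ (f 0 ℤ.* ((g ∘ suc) ⊛ h) n ℤ.+ ((f ∘ suc) ⊛ (g ⊛ h)) n)
    ≡⟨ lemma (f 0) (g 0) (h (suc n)) _ _ ⟩
  f 0 ℤ.* (g 0 ℤ.* h (suc n) ℤ.+ ((g ∘ suc) ⊛ h) n) ℤ.+ ((f ∘ suc) ⊛ (g ⊛ h)) n
    ≡⟨ ≡.cong (λ z → f 0 ℤ.* z ℤ.+ ((f ∘ suc) ⊛ (g ⊛ h)) n) (⊛-suc g h n) ⟨
  f 0 ℤ.* (g ⊛ h) (suc n) ℤ.+ ((f ∘ suc) ⊛ (g ⊛ h)) n
    ≡⟨ ⊛-suc f (g ⊛ h) n ⟨
  (f ⊛ (g ⊛ h)) (suc n) ∎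
  where
  open ≡.≡-Reasoning
  lemma : ∀ a b c d e → a ℤ.* b ℤ.* c ℤ.+ (a ℤ.* d ℤ.+ e) ≡ a ℤ.* (b ℤ.* c ℤ.+ d) ℤ.+ e
  lemma = ℤ-Ring.solve-∀

0⊛ : ∀ g n → ((λ _ → + 0) ⊛ g) n ≡ + 0
0⊛ g n = Σ≤-zero n _ λ i _ → ℤ.*-zeroˡ (g (n ∸ i))

const-⊛ : ∀ c g n → (const c ⊛ g) n ≡ c ℤ.* g n
const-⊛ c g zero    = ≡.refl
const-⊛ c g (suc n) = ≡.trans (⊛-suc (const c) g n)
  (≡.trans (≡.cong (ℤ._+_ (c ℤ.* g (suc n))) (0⊛ g n)) (ℤ.+-identityʳ _))

const-1⊛ : ∀ g n → (const (+ 1) ⊛ g) n ≡ g n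
const-1⊛ g n = ≡.trans (const-⊛ (+ 1) g n) (ℤ.*-identityˡ (g n))

mono-0 : ∀ n → mono 0 n ≡ const (+ 1) n
mono-0 zero    = ≡.refl
mono-0 (suc n) = ≡.refl

mono-suc-⊛ : ∀ k g n → (mono (suc k) ⊛ g) (suc n) ≡ (mono k ⊛ g) n
mono-suc-⊛ k g n = ≡.trans (⊛-suc (mono (suc k)) g n)
  (≡.trans (≡.cong (ℤ._+ (mono k ⊛ g) n) (ℤ.*-zeroˡ (g (suc n)))) (ℤ.+-identityˡ _))

mono-⊛-low : ∀ k g n → n < k → (mono k ⊛ g) n ≡ + 0
mono-⊛-low (suc k) g zero    _         = ℤ.*-zeroˡ (g 0)
mono-⊛-low (suc k) g (suc n) (s≤s n<k) = ≡.trans (mono-suc-⊛ k g n) (mono-⊛-low k g n n<k)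

mono-⊛-high : ∀ k g n → (mono k ⊛ g) (k ℕ.+ n) ≡ g n
mono-⊛-high zero    g n = ≡.trans (⊛-congʳ g n mono-0) (const-1⊛ g n)
mono-⊛-high (suc k) g n = ≡.trans (mono-suc-⊛ k g (k ℕ.+ n)) (mono-⊛-high k g n)

mono-+ : ∀ a b n → mono (a ℕ.+ b) n ≡ (mono a ⊛ mono b) n
mono-+ zero    b n       = ≡.sym (mono-⊛-high 0 (mono b) n)
mono-+ (suc a) b zero    = ≡.sym (mono-⊛-low (suc a) (mono b) 0 (s≤s z≤n))
mono-+ (suc a) b (suc n) = ≡.trans (mono-+ a b n) (≡.sym (mono-suc-⊛ a (mono b) n))

mono-low : ∀ k n → n < k → mono k n ≡ + 0
mono-low (suc k) zero    _         = ≡.refl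
mono-low (suc k) (suc n) (s≤s n<k) = mono-low k n n<k

geom-low : ∀ k n → n < k → geom k n ≡ const (+ 1) n
geom-low k zero    _   = ≡.cong (if_then + 1 else + 0) (dec-true (k ∣? 0) (k ∣0))
geom-low k (suc n) n<k = ≡.cong (if_then + 1 else + 0) (dec-false (k ∣? suc n) (>⇒∤ n<k))

geom-+ : ∀ k n → geom k (k ℕ.+ n) ≡ geom k n
geom-+ k n = ≡.cong (if_then + 1 else + 0)
  (does-⇔ (mk⇔ (λ d → ∣m+n∣m⇒∣n d ∣-refl) (∣m∣n⇒∣m+n ∣-refl)) (k ∣? (k ℕ.+ n)) (k ∣? n))

-- From degree K on, the coefficient is a difference of two values of `geom K` that lie K apart and
-- agree by periodicity. Below K only the constant term is left.
geom-inverse : ∀ k n → (geom (suc k) ⊛ (const (+ 1) ⊕ ⊝ mono (suc k))) n ≡ const (+ 1) n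
geom-inverse k n = begin
  (geom K ⊛ (const (+ 1) ⊕ ⊝ mono K)) n
    ≡⟨ ⊛-comm (geom K) (const (+ 1) ⊕ ⊝ mono K) n ⟩
  ((const (+ 1) ⊕ ⊝ mono K) ⊛ geom K) n
    ≡⟨ ⊛-distribʳ (geom K) (const (+ 1)) (⊝ mono K) n ⟩
  (const (+ 1) ⊛ geom K) n ℤ.+ ((⊝ mono K) ⊛ geom K) n
    ≡⟨ ≡.cong₂ ℤ._+_ (const-1⊛ (geom K) n) negate ⟩
  geom K n ℤ.- (mono K ⊛ geom K) n
    ≡⟨ difference n ⟩
  const (+ 1) n ∎
  where
  open ≡.≡-Reasoning
  K = suc k
  negate : ((⊝ mono K) ⊛ geom K) n ≡ ℤ.- (mono K ⊛ geom K) n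
  negate = ≡.trans (⊛-congʳ (geom K) n (λ i → ≡.sym (ℤ.-1*i≡-i (mono K i))))
    (≡.trans (⊛-scale ℤ.-1ℤ (mono K) (geom K) n) (ℤ.-1*i≡-i _))
  difference : ∀ n → geom K n ℤ.- (mono K ⊛ geom K) n ≡ const (+ 1) n
  difference n with n ℕ.<? K
  ... | yes n<K = ≡.trans (≡.cong₂ ℤ._-_ (geom-low K n n<K) (mono-⊛-low K (geom K) n n<K)) (ℤ.+-identityʳ _)
  ... | no  n≮K with n ∸ K | ℕ.m+[n∸m]≡n (ℕ.≮⇒≥ n≮K)
  ...   | d | ≡.refl = ≡.trans (≡.cong₂ ℤ._-_ (geom-+ K d) (mono-⊛-high K (geom K) d)) (ℤ.+-inverseʳ (geom K d))

-- Power series modulo q^(N+1)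

module Truncation (N : ℕ) where

  infix 4 _≋_
  -- A record instead of a function type, so that f and g can be inferred from the type of a proof.
  record _≋_ (f g : PS) : Set where
    constructor truncated
    field at : ∀ i → i ≤ N → f i ≡ g i
  open _≋_ public

  pointwise : ∀ {f g} → (∀ i → f i ≡ g i) → f ≋ g
  pointwise h = truncated λ i _ → h i

  truncatedRing : ℤ-Algebra
  truncatedRing = record
    { Carrier = PS ; _≈_ = _≋_ ; _+_ = _⊕_ ; _*_ = _⊛_ ; -_ = ⊝_ ; ⟦_⟧ = const
    ; isCommutativeRing = record
      { isRing = record
        { +-isAbelianGroup = record
          { isGroup = record
            { isMonoid = record
              { isSemigroup = record
                { isMagma = record
                  { isEquivalence = record
                    { refl  = pointwise λ _ → ≡.refl
                    ; sym   = λ p → truncated λ i i≤N → ≡.sym (at p i i≤N)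
                    ; trans = λ p q → truncated λ i i≤N → ≡.trans (at p i i≤N) (at q i i≤N)
                    }
                  ; ∙-cong = λ p q → truncated λ i i≤N → ≡.cong₂ ℤ._+_ (at p i i≤N) (at q i i≤N)
                  }
                ; assoc = λ f g h → pointwise λ i → ℤ.+-assoc (f i) (g i) (h i)
                }
              ; identity = (λ f → pointwise (0+ f)) , (λ f → pointwise (+0 f))
              }
            ; inverse = (λ f → pointwise (-+ f)) , (λ f → pointwise (+- f))
            ; ⁻¹-cong = λ p → truncated λ i i≤N → ≡.cong ℤ.-_ (at p i i≤N)
            }
          ; comm = λ f g → pointwise λ i → ℤ.+-comm (f i) (g i)
          }
        ; *-cong = λ p q → truncated λ i i≤N → ⊛-cong i
            (λ l l≤i → at p l (ℕ.≤-trans l≤i i≤N)) (λ l l≤i → at q l (ℕ.≤-trans l≤i i≤N))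
        ; *-assoc = λ f g h → pointwise (⊛-assoc f g h)
        ; *-identity = (λ f → pointwise (const-1⊛ f))
                     , (λ f → pointwise λ i → ≡.trans (⊛-comm f (const (+ 1)) i) (const-1⊛ f i))
        ; distrib = (λ f g h → pointwise λ i → ≡.trans (⊛-comm f (g ⊕ h) i)
                       (≡.trans (⊛-distribʳ f g h i) (≡.cong₂ ℤ._+_ (⊛-comm g f i) (⊛-comm h f i))))
                  , (λ f g h → pointwise (⊛-distribʳ f g h))
        }
      ; *-comm = λ f g → pointwise (⊛-comm f g)
      }
    ; ⟦⟧-+ = λ a b → pointwise λ { zero → ≡.refl ; (suc _) → ≡.refl }
    ; ⟦⟧-* = λ a b → pointwise λ
        { zero → ≡.refl ; (suc n) → ≡.sym (≡.trans (const-⊛ a (const b) (suc n)) (ℤ.*-zeroʳ a)) }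
    ; ⟦⟧-- = λ a → pointwise λ { zero → ≡.refl ; (suc _) → ≡.refl }
    }
    where
    0+ : ∀ f i → const (+ 0) i ℤ.+ f i ≡ f i
    0+ f zero    = ℤ.+-identityˡ (f 0)
    0+ f (suc i) = ℤ.+-identityˡ (f (suc i))
    +0 : ∀ f i → f i ℤ.+ const (+ 0) i ≡ f i
    +0 f zero    = ℤ.+-identityʳ (f 0)
    +0 f (suc i) = ℤ.+-identityʳ (f (suc i))
    +- : ∀ f i → f i ℤ.- f i ≡ const (+ 0) i
    +- f zero    = ℤ.+-inverseʳ (f 0)
    +- f (suc i) = ℤ.+-inverseʳ (f (suc i))
    -+ : ∀ f i → ℤ.- f i ℤ.+ f i ≡ const (+ 0) i
    -+ f zero    = ℤ.+-inverseˡ (f 0)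
    -+ f (suc i) = ℤ.+-inverseˡ (f (suc i))

-- Infinite products of power series.

infinite : (ℕ → PS) → PS
infinite f n = Π≤ n f n

-- f i ≡ 1 modulo q^i, which makes the coefficients of the partial products stabilise.
Convergent : (ℕ → PS) → Set
Convergent f = ∀ i n → n < i → f i n ≡ const (+ 1) n

-- Every factor beyond the n-th is 1 up to degree n. This reconciles the degree-dependent truncation
-- in `poch` and `invPoch` with a product of fixed length.
Π≤-stable : ∀ {f} → Convergent f → ∀ n d → Π≤ (d ℕ.+ n) f n ≡ infinite f n
Π≤-stable         conv n zero    = ≡.refl
Π≤-stable {f} conv n (suc d) = ≡.trans
  (⊛-cong n {f = Π≤ (d ℕ.+ n) f} (λ _ _ → ≡.refl)
    (λ i i≤n → conv (suc (d ℕ.+ n)) i (s≤s (ℕ.≤-trans i≤n (ℕ.m≤n+m n d)))))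
  (≡.trans (⊛-comm (Π≤ (d ℕ.+ n) f) (const (+ 1)) n)
    (≡.trans (const-1⊛ (Π≤ (d ℕ.+ n) f) n) (Π≤-stable conv n d)))

1-q^-low : ∀ k n → n < k → 1-q^ k n ≡ const (+ 1) n
1-q^-low k zero    n<k rewrite mono-low k zero n<k = ≡.refl
1-q^-low k (suc n) n<k rewrite mono-low k (suc n) n<k = ≡.refl

progression-convergent : ∀ {h} → Convergent h → ∀ a b → Convergent (λ i → h (suc a ℕ.+ i ℕ.* suc b))
progression-convergent conv a b i n n<i = conv _ n
  (ℕ.<-≤-trans n<i (ℕ.≤-trans (ℕ.m≤m*n i (suc b)) (ℕ.m≤n+m _ (suc a))))

-- Coefficients of the theta series

σ : ℕ → ℤ
σ j = ℤ.-1ℤ ℤ.^ j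

indicator : ℤ → ℕ → ℕ → ℤ
indicator c e n = if e ≡ᵇ n then c else + 0

≡ᵇ-comm : ∀ m n → (m ≡ᵇ n) ≡ (n ≡ᵇ m)
≡ᵇ-comm zero    zero    = ≡.refl
≡ᵇ-comm zero    (suc n) = ≡.refl
≡ᵇ-comm (suc m) zero    = ≡.refl
≡ᵇ-comm (suc m) (suc n) = ≡ᵇ-comm m n

scaled-mono : ∀ {f c} → (∀ n → f n ≡ const c n) → ∀ e n → (f ⊛ mono e) n ≡ indicator c e n
scaled-mono {f} {c} f≡c e n = ≡.trans (⊛-congʳ (mono e) n f≡c) (≡.trans (const-⊛ c (mono e) n) lemma)
  where
  lemma : c ℤ.* mono e n ≡ indicator c e n
  lemma rewrite ≡ᵇ-comm n e with e ≡ᵇ n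
  ... | true  = ℤ.*-identityʳ c
  ... | false = ℤ.*-zeroʳ c

⊝-const : ∀ {f c} → (∀ n → f n ≡ const c n) → ∀ n → (⊝ f) n ≡ const (ℤ.- c) n
⊝-const f≡c zero    = ≡.cong ℤ.-_ (f≡c 0)
⊝-const f≡c (suc n) = ≡.cong ℤ.-_ (f≡c (suc n))

module Coefficients (N : ℕ) where

  open Truncation N
  open CommutativeRing (ℤ-Algebra.commutativeRing truncatedRing) using (_≈_; *-cong; *-identityˡ; trans; sym)
  open RingLemmas truncatedRing using (∏; ∑; ε; module FiniteQuintuple)
  open FiniteQuintuple mono geom
    (pointwise mono-0) (λ a b → pointwise (mono-+ a b)) (λ k → pointwise (geom-inverse k)) using (T; factor; module Nilpotent)

  mono-large : ∀ e → N < e → mono e ≈ const (+ 0)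
  mono-large e N<e = truncated λ n n≤N → ≡.trans (mono-low e n (ℕ.≤-<-trans n≤N N<e)) (zeros n)
    where
    zeros : ∀ n → + 0 ≡ const (+ 0) n
    zeros zero    = ≡.refl
    zeros (suc _) = ≡.refl

  open Nilpotent N mono-large using (P; I; theta; theta-∑; theta-product; M)

  Π≤≈∏ : ∀ n {f g} → (∀ i → f i ≈ g i) → Π≤ n f ≈ ∏ (suc n) g
  Π≤≈∏ zero    {f} {g} f≈g = trans (f≈g 0) (sym (*-identityˡ (g 0)))
  Π≤≈∏ (suc n) f≈g = *-cong (Π≤≈∏ n f≈g) (f≈g (suc n))

  infinite≈Π≤ : ∀ {f} → Convergent f → infinite f ≈ Π≤ N f
  infinite≈Π≤ {f} conv = truncated λ i i≤N → ≡.trans (≡.sym (Π≤-stable conv i (N ∸ i)))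
    (≡.cong (λ l → Π≤ l f i) (ℕ.m∸n+n≡m i≤N))

  poch≈P : ∀ a b → poch (suc a) (suc b) ≈ P (suc a) (suc b)
  poch≈P a b = trans (infinite≈Π≤ (progression-convergent 1-q^-low a b))
    (Π≤≈∏ N λ i → pointwise (1-q^≡factor (suc a ℕ.+ i ℕ.* suc b)))
    where
    1-q^≡factor : ∀ k n → 1-q^ k n ≡ factor k n
    1-q^≡factor k zero    = ≡.refl
    1-q^≡factor k (suc n) = ≡.refl

  invPoch≈I : ∀ a b → invPoch (suc a) (suc b) ≈ I (suc a) (suc b)
  invPoch≈I a b = trans (infinite≈Π≤ (progression-convergent geom-low a b))
    (Π≤≈∏ N λ i → pointwise λ _ → ≡.refl)

  theta≈rhs12 : theta M ≈ rhs12
  theta≈rhs12 = theta-product (poch≈P 1 7) (poch≈P 5 7) (poch≈P 7 7) (poch≈P 3 15) (poch≈P 11 15)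
    (invPoch≈I 1 4) (invPoch≈I 2 4)

  ∑-coefficient : ∀ m f n → ∑ m f n ≡ Σ≤ m (λ j → f j n)
  ∑-coefficient zero    f n = ≡.refl
  ∑-coefficient (suc m) f n = ≡.cong (ℤ._+ f (suc m) n) (∑-coefficient m f n)

  ε-pos : ∀ j n → ε (+ j) n ≡ const (σ j) n
  ε-pos zero    n = ≡.refl
  ε-pos (suc j) n = ≡.trans (⊝-const (ε-pos j) n) (≡.cong (λ c → const c n) (≡.sym (ℤ.-1*i≡-i (σ j))))

  ε-neg : ∀ j n → ε -[1+ j ] n ≡ const (ℤ.- σ j) n
  ε-neg zero    n = ⊝-const (λ _ → ≡.refl) n
  ε-neg (suc j) n = ≡.trans (⊝-const (ε-neg j) n) (≡.cong (λ c → const (ℤ.- c) n) (≡.sym (ℤ.-1*i≡-i (σ j))))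

  -- What k = j and k = -1 - j contribute to the coefficient of q^N; their signs are (-1)^j and
  -- -(-1)^j.
  block : ℕ → ℤ
  block j = (indicator (σ j) (u (+ j)) N ℤ.+ indicator (σ j) (v (+ j)) N) ℤ.+
    (indicator (ℤ.- σ j) (u -[1+ j ]) N ℤ.+ indicator (ℤ.- σ j) (v -[1+ j ]) N)

  rhs12-coefficient : rhs12 N ≡ Σ≤ M block
  rhs12-coefficient = begin
    rhs12 N                                      ≡⟨ at theta≈rhs12 N ℕ.≤-refl ⟨
    theta M N                                    ≡⟨ at (theta-∑ M) N ℕ.≤-refl ⟩
    ∑ M (λ j → T (+ j) ⊕ T -[1+ j ]) N           ≡⟨ ∑-coefficient M (λ j → T (+ j) ⊕ T -[1+ j ]) N ⟩
    Σ≤ M (λ j → T (+ j) N ℤ.+ T -[1+ j ] N)      ≡⟨ Σ≤-cong M (λ j _ → ≡.cong₂ ℤ._+_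
      (≡.cong₂ ℤ._+_ (scaled-mono (ε-pos j) (u (+ j)) N) (scaled-mono (ε-pos j) (v (+ j)) N))
      (≡.cong₂ ℤ._+_ (scaled-mono (ε-neg j) (u -[1+ j ]) N) (scaled-mono (ε-neg j) (v -[1+ j ]) N))) ⟩
    Σ≤ M block                                   ∎
    where open ≡.≡-Reasoning

-- The enumeration of the exponents

open import Data.Nat using (_+_; _*_)

Increasing : (ℕ → ℕ) → Set
Increasing f = ∀ {m n} → m < n → f m < f n

step⇒increasing : ∀ {f} → (∀ n → f n < f (suc n)) → Increasing f
step⇒increasing {f} step {m} {suc n} (s≤s m≤n) with ℕ.m≤n⇒m<n∨m≡n m≤n
... | inj₁ m<n    = ℕ.<-trans (step⇒increasing step m<n) (step n)
... | inj₂ ≡.refl = step m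

increasing⇒mono : ∀ {f} → Increasing f → ∀ {m n} → m ≤ n → f m ≤ f n
increasing⇒mono inc m≤n with ℕ.m≤n⇒m<n∨m≡n m≤n
... | inj₁ m<n    = ℕ.<⇒≤ (inc m<n)
... | inj₂ ≡.refl = ℕ.≤-refl

increasing⇒≥id : ∀ {f} → Increasing f → ∀ n → n ≤ f n
increasing⇒≥id inc zero    = z≤n
increasing⇒≥id inc (suc n) = ℕ.≤-<-trans (increasing⇒≥id inc n) (inc (ℕ.n<1+n n))

-- The position of f n among the values of g increases with n, hence is at least n.
increasing-⊆⇒≤ : ∀ {f g} → Increasing f → Increasing g → (∀ n → ∃[ j ] g j ≡ f n) → ∀ n → g n ≤ f n
increasing-⊆⇒≤ {f} {g} f-inc g-inc f⊆g n =
  ≡.subst (g n ≤_) (proj₂ (f⊆g n)) (increasing⇒mono g-inc (increasing⇒≥id index-inc n))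
  where
  index : ℕ → ℕ
  index = proj₁ ∘ f⊆g
  index-inc : Increasing index
  index-inc {m} {n} m<n = ℕ.≰⇒> λ n≤m → ℕ.<⇒≱ (f-inc m<n)
    (≡.subst₂ _≤_ (proj₂ (f⊆g n)) (proj₂ (f⊆g m)) (increasing⇒mono g-inc n≤m))

-- root j and exponent j enumerate, from the j-th period on, the k ≡ ±2, ±7 (mod 15)
-- and the corresponding (k² − 4) / 15.
root exponent : ℕ → ℕ → ℕ
root j 0 = 2 + j * 15
root j 1 = 7 + j * 15
root j 2 = 8 + j * 15
root j 3 = 13 + j * 15
root j (suc (suc (suc (suc n)))) = root (suc j) n
exponent j 0 = u (+ j)
exponent j 1 = v (+ j)
exponent j 2 = v -[1+ j ]
exponent j 3 = u -[1+ j ]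
exponent j (suc (suc (suc (suc n)))) = exponent (suc j) n

root-square : ∀ j n → root j n * root j n ≡ 15 * exponent j n + 4
root-square j 0 = lemma j
  where
  lemma : ∀ j → (2 + j * 15) * (2 + j * 15) ≡ 15 * (j * (15 * j + 4)) + 4
  lemma = ℕ-Ring.solve-∀
root-square j 1 = lemma j
  where
  lemma : ∀ j → (7 + j * 15) * (7 + j * 15) ≡ 15 * ((5 * j + 3) * (3 * j + 1)) + 4
  lemma = ℕ-Ring.solve-∀
root-square j 2 = lemma j
  where
  lemma : ∀ j → (8 + j * 15) * (8 + j * 15) ≡ 15 * ((5 * j + 2) * (3 * j + 2)) + 4
  lemma = ℕ-Ring.solve-∀
root-square j 3 = lemma j
  where
  lemma : ∀ j → (13 + j * 15) * (13 + j * 15) ≡ 15 * (suc j * (15 * j + 11)) + 4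
  lemma = ℕ-Ring.solve-∀
root-square j (suc (suc (suc (suc n)))) = root-square (suc j) n

root-step : ∀ j n → root j n < root j (suc n)
root-step j 0 = ℕ.+-monoˡ-< (j * 15) (ℕ.m≤m+n 3 4)
root-step j 1 = ℕ.+-monoˡ-< (j * 15) (ℕ.m≤m+n 8 0)
root-step j 2 = ℕ.+-monoˡ-< (j * 15) (ℕ.m≤m+n 9 4)
root-step j 3 = ℕ.+-monoˡ-< (j * 15) (ℕ.m≤m+n 14 3)
root-step j (suc (suc (suc (suc n)))) = root-step (suc j) n

-- The roots increase, so their squares 15e + 4 do, and with them the exponents e.
exponent-increasing : Increasing (exponent 0)
exponent-increasing {m} {n} m<n = ℕ.*-cancelˡ-< 15 _ _ (ℕ.+-cancelʳ-< 4 _ _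
  (≡.subst₂ _<_ (root-square 0 m) (root-square 0 n) (ℕ.*-mono-< root< root<)))
  where
  root< : root 0 m < root 0 n
  root< = step⇒increasing (root-step 0) m<n

exponent-period : ∀ j i r → exponent i (r + j * 4) ≡ exponent (j + i) r
exponent-period zero    i r = ≡.cong (exponent i) (ℕ.+-identityʳ r)
exponent-period (suc j) i r = ≡.trans (≡.cong (exponent i) (lemma r (j * 4)))
  (≡.trans (exponent-period j (suc i) r) (≡.cong (λ l → exponent l r) (ℕ.+-suc j i)))
  where
  lemma : ∀ r x → r + (4 + x) ≡ 4 + (r + x)
  lemma = ℕ-Ring.solve-∀

exponent-period₀ : ∀ j r → exponent 0 (r + j * 4) ≡ exponent j r
exponent-period₀ j r = ≡.trans (exponent-period j 0 r) (≡.cong (λ l → exponent l r) (ℕ.+-identityʳ j))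

-- The square roots of 4 modulo 15 are ±2 and ±7; s is the place of the residue within a period of
-- `root`. All other residues are refuted by evaluating r² mod 15.
square-residue : ∀ r → r < 15 → (r * r) % 15 ≡ 4 → ∃[ s ] (∀ d → r + d * 15 ≡ root d s)
square-residue 2  _ _ = 0 , λ _ → ≡.refl
square-residue 7  _ _ = 1 , λ _ → ≡.refl
square-residue 8  _ _ = 2 , λ _ → ≡.refl
square-residue 13 _ _ = 3 , λ _ → ≡.refl
square-residue 0  _ ()
square-residue 1  _ ()
square-residue 3  _ ()
square-residue 4  _ ()
square-residue 5  _ ()
square-residue 6  _ ()
square-residue 9  _ ()
square-residue 10 _ ()
square-residue 11 _ ()
square-residue 12 _ ()
square-residue 14 _ ()
square-residue (suc (suc (suc (suc (suc (suc (suc (suc (suc (suc (suc (suc (suc (suc (suc r))))))))))))))) r<15 _ =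
  contradiction r<15 (ℕ.≤⇒≯ (ℕ.m≤m+n 15 r))

square⇒exponent : ∀ k m → k * k ≡ 15 * m + 4 → ∃[ n ] exponent 0 n ≡ m
square⇒exponent k m eq = from-residue (k % 15) (k / 15) (m%n<n k 15)
  (≡.trans (≡.sym (≡.cong (λ l → l * l) (m≡m%n+[m/n]*n k 15))) eq)
  where
  expand : ∀ r d → (r + d * 15) * (r + d * 15) ≡ r * r + (2 * r * d + d * d * 15) * 15
  expand = ℕ-Ring.solve-∀
  rearrange : ∀ m → 15 * m + 4 ≡ 4 + m * 15
  rearrange = ℕ-Ring.solve-∀
  residue : ∀ r d → (r + d * 15) * (r + d * 15) ≡ 15 * m + 4 → (r * r) % 15 ≡ 4
  residue r d sq = ≡.trans (≡.sym ([m+kn]%n≡m%n (r * r) (2 * r * d + d * d * 15) 15))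
    (≡.trans (≡.cong (_% 15) (≡.trans (≡.sym (expand r d)) (≡.trans sq (rearrange m))))
      ([m+kn]%n≡m%n 4 m 15))
  from-residue : ∀ r d → r < 15 → (r + d * 15) * (r + d * 15) ≡ 15 * m + 4 → ∃[ n ] exponent 0 n ≡ m
  from-residue r d r<15 sq =
    let s , r+15d≡root = square-residue r r<15 (residue r d sq) in
    s + d * 4 , ≡.trans (exponent-period₀ d s)
      (ℕ.*-cancelˡ-≡ _ _ 15 (ℕ.+-cancelʳ-≡ 4 _ _
        (≡.trans (≡.sym (root-square d s)) (≡.trans (≡.sym (≡.cong (λ l → l * l) (r+15d≡root d))) sq))))

-- Two increasing sequences with the same set of values bound each other from above.
enumeration-unique : ∀ a → Increasing a → (∀ m → (∃[ n ] a n ≡ m) ⇔ (∃[ k ] k * k ≡ 15 * m + 4)) →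
  ∀ n → a n ≡ exponent 0 n
enumeration-unique a a-inc image n = ℕ.≤-antisym
  (increasing-⊆⇒≤ exponent-increasing a-inc
    (λ n → Equivalence.from (image (exponent 0 n)) (root 0 n , root-square 0 n)) n)
  (increasing-⊆⇒≤ a-inc exponent-increasing
    (λ n → let k , eq = Equivalence.to (image (a n)) (n , ≡.refl) in square⇒exponent k (a n) eq) n)

-- Signs, and grouping of the series into periods of four terms.

sgn-period : ∀ j r → sgn (r + j * 4) ≡ sgn r ℤ.* σ j
sgn-period j r = ≡.trans (≡.cong (ℤ.-1ℤ ℤ.^_) quotient) (ℤ.^-distribˡ-+-* ℤ.-1ℤ ((r + 2) / 4) j)
  where
  rearrange : ∀ r x → r + x + 2 ≡ r + 2 + x
  rearrange = ℕ-Ring.solve-∀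
  quotient : (r + j * 4 + 2) / 4 ≡ (r + 2) / 4 + j
  quotient = ≡.trans (≡.cong (_/ 4) (rearrange r (j * 4)))
    (≡.trans (+-distrib-/-∣ʳ (r + 2) (divides j ≡.refl)) (≡.cong (_+_ ((r + 2) / 4)) (m*n/n≡m j 4)))

Σ≤-extend : ∀ {f} N → (∀ i → N < i → f i ≡ + 0) → ∀ d → Σ≤ (d + N) f ≡ Σ≤ N f
Σ≤-extend N vanish zero    = ≡.refl
Σ≤-extend {f} N vanish (suc d) = ≡.trans
  (≡.cong₂ ℤ._+_ (Σ≤-extend N vanish d) (vanish (suc (d + N)) (s≤s (ℕ.m≤n+m N d))))
  (ℤ.+-identityʳ (Σ≤ N f))

-- The order 0, 1, 3, 2 inside a period is the order u(j), v(j), u(-1-j), v(-1-j) of the summands of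
-- `block`.
Σ≤-quadruples : ∀ m f → Σ≤ (3 + m * 4) f ≡
  Σ≤ m (λ j → (f (j * 4) ℤ.+ f (1 + j * 4)) ℤ.+ (f (3 + j * 4) ℤ.+ f (2 + j * 4)))
Σ≤-quadruples zero    f = lemma (f 0) (f 1) (f 2) (f 3)
  where
  lemma : ∀ a b c d → a ℤ.+ b ℤ.+ c ℤ.+ d ≡ (a ℤ.+ b) ℤ.+ (d ℤ.+ c)
  lemma = ℤ-Ring.solve-∀
Σ≤-quadruples (suc m) f = ≡.trans
  (lemma (Σ≤ (3 + m * 4) f) (f (suc m * 4)) (f (1 + suc m * 4)) (f (2 + suc m * 4)) (f (3 + suc m * 4)))
  (≡.cong (ℤ._+ ((f (suc m * 4) ℤ.+ f (1 + suc m * 4)) ℤ.+ (f (3 + suc m * 4) ℤ.+ f (2 + suc m * 4)))) (Σ≤-quadruples m f))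
  where
  lemma : ∀ s a b c d → s ℤ.+ a ℤ.+ b ℤ.+ c ℤ.+ d ≡ s ℤ.+ ((a ℤ.+ b) ℤ.+ (d ℤ.+ c))
  lemma = ℤ-Ring.solve-∀

module _ (N : ℕ) where
  open Coefficients N using (block; rhs12-coefficient)

  private
    term : ℕ → ℤ
    term n = indicator (sgn n) (exponent 0 n) N

    term-vanish : ∀ n → N < n → term n ≡ + 0
    term-vanish n N<n = ≡.cong (if_then sgn n else + 0)
      (dec-false (exponent 0 n ℕ.≟ N) (ℕ.>⇒≢ (ℕ.<-≤-trans N<n (increasing⇒≥id exponent-increasing n))))

    term-period : ∀ j r → term (r + j * 4) ≡ indicator (sgn r ℤ.* σ j) (exponent j r) N
    term-period j r = ≡.cong₂ (λ c e → indicator c e N) (sgn-period j r) (exponent-period₀ j r)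

    term-signed : ∀ j r c → sgn r ℤ.* σ j ≡ c → term (r + j * 4) ≡ indicator c (exponent j r) N
    term-signed j r c eq = ≡.trans (term-period j r) (≡.cong (λ c → indicator c (exponent j r) N) eq)

    block-terms : ∀ j → (term (j * 4) ℤ.+ term (1 + j * 4)) ℤ.+ (term (3 + j * 4) ℤ.+ term (2 + j * 4)) ≡ block j
    block-terms j = ≡.cong₂ ℤ._+_
      -- By evaluation `sgn` is 1 at 0 and 1, and -1 at 2 and 3.
      (≡.cong₂ ℤ._+_ (term-signed j 0 _ (ℤ.*-identityˡ _)) (term-signed j 1 _ (ℤ.*-identityˡ _)))
      (≡.cong₂ ℤ._+_ (term-signed j 3 _ (ℤ.-1*i≡-i _)) (term-signed j 2 _ (ℤ.-1*i≡-i _)))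

  series-coefficient : Σ≤ N term ≡ rhs12 N
  series-coefficient = begin
    -- The sum is lengthened to M + 1 whole periods; the new terms vanish because the n-th exponent
    -- is at least n > N.
    Σ≤ N term                   ≡⟨ Σ≤-extend N term-vanish (3 + M * 4 ∸ N) ⟨
    Σ≤ (3 + M * 4 ∸ N + N) term ≡⟨ ≡.cong (λ n → Σ≤ n term) (ℕ.m∸n+n≡m N≤3+4M) ⟩
    Σ≤ (3 + M * 4) term         ≡⟨ Σ≤-quadruples M term ⟩
    _                           ≡⟨ Σ≤-cong M (λ j _ → block-terms j) ⟩
    Σ≤ M block                  ≡⟨ rhs12-coefficient ⟨
    rhs12 N                     ∎
    where
    open ≡.≡-Reasoning
    M = suc (N + N)
    N≤3+4M : N ≤ 3 + M * 4
    N≤3+4M = ℕ.≤-trans (ℕ.m≤n⇒m≤1+n (ℕ.m≤m+n N N)) (ℕ.≤-trans (ℕ.m≤m*n M 4) (ℕ.m≤n+m (M * 4) 3))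

theorem12 : (a : ℕ → ℕ)
    → (∀ {m n} → m < n → a m < a n)
    → (∀ m → (∃[ n ] a n ≡ m) ⇔ (∃[ k ] k * k ≡ 15 * m + 4))
    → ∀ N → seriesAt sgn a N ≡ rhs12 N
-- `seriesAt` unfolds to a sum of `indicator` terms, so it remains to replace the exponents by the
-- explicit enumeration.
theorem12 a a-inc image N = ≡.trans
  (Σ≤-cong N λ n _ → ≡.cong (λ e → indicator (sgn n) e N) (enumeration-unique a a-inc image n))
  (series-coefficient N)
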